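{- The Minimum Liar's VE-Domination Problem can be approximated within a factor of $O(\ln \Delta(G))$, where $\Delta(G)$ is the maximum degree of the input graph $G$; that is, there is a polynomial-time algorithm which, given a graph $G$, outputs a liar's ve-dominating set of $G$ whose cardinality is at most $O(\ln\Delta(G))$ times the minimum cardinality of a liar's ve-dominating set of $G$.
   Context: Graphs are finite, simple and undirected. For a graph $G=(V,E)$ and $v\in V$, $N_G(v)=\{u\in V : uv\in E\}$ and $N_G[v]=N_G(v)\cup\{v\}$. For an edge $e=xy\in E$, $N_G[e]=N_G[x]\cup N_G[y]$. A set $L\subseteq V$ is a liar's ve-dominating (vertex-edge dominating) set of $G$ if (i) for every $e\in E$, $|N_G[e]\cap L|\ge 2$, and (ii) for every pair of distinct edges $e,e'\in E$, $|(N_G[e]\cup N_G[e'])\cap L|\ge 3$. Minimum Liar's VE-Domination Problem: given a graph $G$, output a liar's ve-dominating set of $G$ of minimum cardinality. -}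

module Defs where

open import Data.Bool.Base using (Bool; true; false; if_then_else_; _∧_)
open import Data.Fin.Base as Fin using (Fin; toℕ; fromℕ<; remQuot)
open import Data.Fin.Subset using (Subset; ∣_∣; _∩_; _∪_; ⁅_⁆)
open import Data.List.Base using (List; map; allFin)
open import Data.List.Extrema.Nat using (max)
open import Data.Nat.Base
open import Data.Nat.Properties using (_<?_)
open import Data.Product.Base using (∃; _×_; uncurry)
open import Data.Vec.Base using (tabulate)
open import Relation.Binary.PropositionalEquality using (_≡_; _≢_)
open import Relation.Nullary.Decidable.Core using (yes; no)

record Graph (n : ℕ) : Set where
  field
    adj    : Fin n → Fin n → Bool
    sym    : ∀ u v → adj u v ≡ adj v u
    irrefl : ∀ v → adj v v ≡ false

open Graph public

-- An edge is stored with its endpoints in increasing order, so that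
-- propositional equality of edges is equality of unordered pairs.

record Edge {n : ℕ} (G : Graph n) : Set where
  constructor edge
  field
    x y      : Fin n
    x<y      : x Fin.< y
    adjacent : adj G x y ≡ true

module _ {n : ℕ} (G : Graph n) where

  N : Fin n → Subset n
  N v = tabulate (adj G v)

  N[_] : Fin n → Subset n
  N[ v ] = N v ∪ ⁅ v ⁆

  Nₑ[_] : Edge G → Subset n
  Nₑ[ e ] = N[ Edge.x e ] ∪ N[ Edge.y e ]

  degree : Fin n → ℕ
  degree v = ∣ N v ∣

  Δ : ℕ
  Δ = max 0 (map degree (allFin n))

  record LiarsVEDominating (L : Subset n) : Set where
    field
      single : ∀ e → ∣ Nₑ[ e ] ∩ L ∣ ≥ 2
      pair   : ∀ e e′ → e ≢ e′ → ∣ (Nₑ[ e ] ∪ Nₑ[ e′ ]) ∩ L ∣ ≥ 3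

  record MinimumLiarsVECardinality (m : ℕ) : Set where
    field
      attained : ∃ λ L → LiarsVEDominating L × ∣ L ∣ ≡ m
      minimal  : ∀ L → LiarsVEDominating L → m ≤ ∣ L ∣

-- expSum k is k! times the partial sum 1/0! + 1/1! + … + 1/k! of e.

expSum : ℕ → ℕ
expSum zero    = 1
expSum (suc k) = suc k * expSum k + 1

-- x ≤ c · ln d, for d ≥ 1, in the form eˣ ≤ dᶜ: since e is the supremum
-- of expSum k / k!, this says (expSum k / k!)ˣ ≤ dᶜ for every k.

_≤_·ln_ : ℕ → ℕ → ℕ → Set
x ≤ c ·ln d = ∀ k → expSum k ^ x ≤ (k !) ^ x * d ^ c

-- f(d) = O(ln d) as d → ∞.  Natural-number values and constants lose
-- nothing, because ln d ≥ 1 for d ≥ 3 and so both can be rounded up.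

IsO[ln] : (ℕ → ℕ) → Set
IsO[ln] f = ∃ λ c → ∃ λ d₀ → ∀ d → d ≥ d₀ → f d ≤ c ·ln d

-- The memory consists of arrays of natural numbers, named by numerals
-- occurring in the program; `σ a i` is the content of cell i of array a.

Store : Set
Store = ℕ → ℕ → ℕ

_[_,_↦_] : Store → ℕ → ℕ → ℕ → Store
(σ [ a , i ↦ v ]) b j = if (a ≡ᵇ b) ∧ (i ≡ᵇ j) then v else σ b j

-- There is deliberately no multiplication: at unit cost it would square
-- numbers repeatedly and take the model outside polynomial time.  With
-- addition and truncated subtraction, bit lengths grow by O(1) per step,
-- so unit-cost time is polynomially related to Turing machine time.

infixl 6 _⊕_ _⊖_

data Expr : Set where
  const   : ℕ → Expr
  _[_]    : ℕ → Expr → Expr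
  _⊕_ _⊖_ : Expr → Expr → Expr

eval : Expr → Store → ℕ
eval (const k) σ = k
eval (a [ e ]) σ = σ a (eval e σ)
eval (e ⊕ e′)  σ = eval e σ + eval e′ σ
eval (e ⊖ e′)  σ = eval e σ ∸ eval e′ σ

cost : Expr → ℕ
cost (const k) = 1
cost (a [ e ]) = suc (cost e)
cost (e ⊕ e′)  = suc (cost e + cost e′)
cost (e ⊖ e′)  = suc (cost e + cost e′)

infix  5 _[_]≔_
infixr 4 _⨾_

data Program : Set where
  skip    : Program
  _[_]≔_  : ℕ → Expr → Expr → Program
  _⨾_     : Program → Program → Program
  if′     : Expr → Program → Program → Program
  while   : Expr → Program → Program

-- ⟨ P , σ ⟩⇓[ t ] τ : started in σ, P halts in τ after t steps.
-- A guard holds when its value is nonzero.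

infix 3 ⟨_,_⟩⇓[_]_

data ⟨_,_⟩⇓[_]_ : Program → Store → ℕ → Store → Set where
  ⇓skip : ∀ {σ} → ⟨ skip , σ ⟩⇓[ 1 ] σ
  ⇓assign : ∀ {σ a i e} →
    ⟨ a [ i ]≔ e , σ ⟩⇓[ suc (cost i + cost e) ] σ [ a , eval i σ ↦ eval e σ ]
  ⇓seq : ∀ {P Q σ τ υ s t} →
    ⟨ P , σ ⟩⇓[ s ] τ → ⟨ Q , τ ⟩⇓[ t ] υ →
    ⟨ P ⨾ Q , σ ⟩⇓[ s + t ] υ
  ⇓if-true : ∀ {e P Q σ τ t} →
    eval e σ ≢ 0 → ⟨ P , σ ⟩⇓[ t ] τ →
    ⟨ if′ e P Q , σ ⟩⇓[ suc (cost e + t) ] τ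
  ⇓if-false : ∀ {e P Q σ τ t} →
    eval e σ ≡ 0 → ⟨ Q , σ ⟩⇓[ t ] τ →
    ⟨ if′ e P Q , σ ⟩⇓[ suc (cost e + t) ] τ
  ⇓while-true : ∀ {e P σ τ υ s t} →
    eval e σ ≢ 0 → ⟨ P , σ ⟩⇓[ s ] τ → ⟨ while e P , τ ⟩⇓[ t ] υ →
    ⟨ while e P , σ ⟩⇓[ suc (cost e + s + t) ] υ
  ⇓while-false : ∀ {e P σ} →
    eval e σ ≡ 0 →
    ⟨ while e P , σ ⟩⇓[ suc (cost e) ] σ

-- Array 0 holds n in cell 0; array 1 holds the adjacency matrix row by
-- row, entry (i , j) in cell n * i + j.  All other cells are 0.

adjacencyMatrix : ∀ {n} → Graph n → ℕ → ℕ
adjacencyMatrix {n} G k with k <? n * n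
... | yes k<n² = if uncurry (adj G) (remQuot {n} n (fromℕ< k<n²)) then 1 else 0
... | no  _    = 0

input : ∀ {n} → Graph n → Store
input {n} G 0 0 = n
input {n} G 1 k = adjacencyMatrix G k
input {n} G _ _ = 0

-- The answer is read off array 2: v is selected when cell v is nonzero.

output : ∀ n → Store → Subset n
output n σ = tabulate λ v → 0 <ᵇ σ 2 (toℕ v)

-- The input has n² + 1 cells with values at most max n 1, so polynomial
-- in the input length means polynomial in n; the successor covers n = 0.

PolynomialTime : Program → Set
PolynomialTime P = ∃ λ c → ∃ λ k → ∀ n (G : Graph n) →
  ∃ λ t → ∃ λ σ → (⟨ P , input G ⟩⇓[ t ] σ) × t ≤ c * suc n ^ k

-- f is the guaranteed approximation factor, as a function of Δ(G).

ApproximatesMinimumLiarsVE : (ℕ → ℕ) → Program → Set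
ApproximatesMinimumLiarsVE f P =
  ∀ n (G : Graph n) t σ → ⟨ P , input G ⟩⇓[ t ] σ →
    LiarsVEDominating G (output n σ) ×
    (∀ m → MinimumLiarsVECardinality G m → ∣ output n σ ∣ ≤ f (Δ G) * m)

{-# OPTIONS --safe #-}

-- Greedy multicover.  The constraints are tuples (x, y, x′, y′, w) where xy and x′y′
-- are edges whose closed neighbourhoods share w; such a tuple asks for 2 dominators if
-- the edges coincide and for 3 otherwise.  Pairs of edges with disjoint neighbourhoods
-- are then automatically dominated 2 + 2 ≥ 3 times, so a set is liar's ve-dominating iff
-- its potential, the total unmet demand, vanishes.  Every tuple that a vertex v can help
-- lies within distance 5 of v, hence v helps at most (Δ + 1)²⁵ tuples.
--
-- Against a solution of size m, the best vertex lowers the potential by at least its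
-- m-th part, so m greedy steps halve it; it starts at most m (Δ + 1)²⁵, so 25 m ⌈log₂ (Δ + 1)⌉
-- steps bring it down to m, and m further steps to 0.
--
-- The potential, and the index of the best vertex, are nested bounded sums; they are
-- written in a small language of such sums, compiled to programs once and for all.

module Submission where

open import Axiom.UniquenessOfIdentityProofs using (module Decidable⇒UIP)
open import Data.Bool.Base using (Bool; true; false; if_then_else_; _∧_; _∨_; not; T)
open import Data.Bool.Properties as Bool using (T-≡)
open import Data.Fin.Base as Fin using (Fin; zero; suc; toℕ; fromℕ<; _↑ʳ_; combine; remQuot)
open import Data.Fin.Patterns
open import Data.Fin.Properties as Fin using
  (any?; toℕ<n; toℕ-injective; toℕ-inject₁; toℕ-fromℕ; toℕ-fromℕ<; toℕ-combine; remQuot-combine)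
open import Data.Fin.Subset using (Subset; ∣_∣; _∩_; _∪_; ⁅_⁆)
open import Data.List.Base as List using (allFin)
open import Data.List.Extrema.Nat using (xs≤max)
open import Data.List.Membership.Propositional.Properties using (∈-map⁺; ∈-allFin)
open import Data.List.Relation.Unary.All as All using ()
open import Data.Nat.Base
open import Data.Nat.Properties
open import Data.Product.Base using (∃; ∃₂; _×_; _,_; proj₁; proj₂; uncurry)
open import Data.Sum.Base using (_⊎_; inj₁; inj₂)
open import Data.Vec.Base using (Vec; []; _∷_; _++_; map; lookup)
open import Data.Vec.Properties using (lookup-zipWith; lookup∘tabulate; lookup-replicate)
open import Function.Base using (_∘_; _$_)
open import Function.Bundles using (Equivalence)
open import Relation.Binary.Definitions using (tri<; tri≈; tri>)
open import Relation.Binary.PropositionalEquality hiding ([_])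
open import Relation.Nullary.Decidable.Core using (yes; no)
open import Relation.Nullary.Negation using (contradiction)
open import Defs renaming (sym to adj-sym)

open import Algebra.Properties.Semiring.Sum +-*-semiring
  using (sum; sum-cong-≗; sum-init-last; ∑-distrib-+; ∑-comm; *-distribˡ-sum; *-distribʳ-sum)

-- Programs computing bounded sums

-- `ApproximatesMinimumLiarsVE` speaks about every halting run; determinism reduces this to the one
-- run that is constructed.
deterministic : ∀ {P σ s t τ υ} → ⟨ P , σ ⟩⇓[ s ] τ → ⟨ P , σ ⟩⇓[ t ] υ → τ ≡ υ
deterministic ⇓skip ⇓skip = refl
deterministic ⇓assign ⇓assign = refl
deterministic (⇓seq p q) (⇓seq p′ q′)
  with refl ← deterministic p p′ = deterministic q q′
deterministic (⇓if-true _ p) (⇓if-true _ p′) = deterministic p p′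
deterministic (⇓if-true ≢0 _) (⇓if-false ≡0 _) = contradiction ≡0 ≢0
deterministic (⇓if-false ≡0 _) (⇓if-true ≢0 _) = contradiction ≡0 ≢0
deterministic (⇓if-false _ p) (⇓if-false _ p′) = deterministic p p′
deterministic (⇓while-true _ p q) (⇓while-true _ p′ q′)
  with refl ← deterministic p p′ = deterministic q q′
deterministic (⇓while-true ≢0 _ _) (⇓while-false ≡0) = contradiction ≡0 ≢0
deterministic (⇓while-false ≡0) (⇓while-true ≢0 _ _) = contradiction ≡0 ≢0
deterministic (⇓while-false _) (⇓while-false _) = refl

≡ᵇ-refl : ∀ n → (n ≡ᵇ n) ≡ true
≡ᵇ-refl n = Equivalence.to T-≡ (≡⇒≡ᵇ n n refl)

≢⇒≡ᵇ-false : ∀ {m n} → m ≢ n → (m ≡ᵇ n) ≡ false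
≢⇒≡ᵇ-false {m} {n} m≢n with m ≡ᵇ n | ≡ᵇ⇒≡ m n
... | false | _    = refl
... | true  | m≡n  = contradiction (m≡n _) m≢n

update-self : ∀ σ a v → (σ [ a , 0 ↦ v ]) a 0 ≡ v
update-self σ a v rewrite ≡ᵇ-refl a = refl

update-other : ∀ σ {a b} i v j → a ≢ b → (σ [ a , i ↦ v ]) b j ≡ σ b j
update-other σ i v j a≢b rewrite ≢⇒≡ᵇ-false a≢b = refl

AgreeBelow : ℕ → Store → Store → Set
AgreeBelow a σ τ = ∀ b i → b < a → τ b i ≡ σ b i

agree-trans : ∀ {a b σ τ υ} → a ≤ b → AgreeBelow a σ τ → AgreeBelow b τ υ → AgreeBelow a σ υ
agree-trans a≤b p q b i b<a = trans (q b i (<-≤-trans b<a a≤b)) (p b i b<a)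

agree-update : ∀ σ a i v → AgreeBelow a σ (σ [ a , i ↦ v ])
agree-update σ a i v b j b<a = update-other σ i v j (>⇒≢ b<a)

-- A failing guard costs 3; a round costs 3 for the guard plus `s` for the body.
loopTime : ℕ → ℕ → ℕ
loopTime s zero    = 3
loopTime s (suc k) = suc (2 + s + loopTime s k)

loopTime-closed : ∀ s k → loopTime s k ≡ 3 + k * (3 + s)
loopTime-closed s zero    = refl
loopTime-closed s (suc k) = cong (3 +_) $ begin
  s + loopTime s k       ≡⟨ cong (s +_) (loopTime-closed s k) ⟩
  s + (3 + k * (3 + s))  ≡⟨ +-assoc s 3 _ ⟨
  s + 3 + k * (3 + s)    ≡⟨ cong (_+ k * (3 + s)) (+-comm s 3) ⟩
  3 + s + k * (3 + s)    ∎
  where open ≡-Reasoning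

-- The index of `I` is the number of rounds still to run. Every round takes exactly `s` steps, so
-- the total time is exact.
module _ {P : Program} {c s : ℕ} (I : ℕ → Store → Set)
  (counter : ∀ k σ → I k σ → σ c 0 ≡ k)
  (body : ∀ k σ → I (suc k) σ → ∃ λ τ → (⟨ P , σ ⟩⇓[ s ] τ) × I k τ) where

  countdown : ∀ k σ → I k σ →
    ∃ λ τ → (⟨ while (c [ const 0 ]) P , σ ⟩⇓[ loopTime s k ] τ) × I 0 τ
  countdown zero    σ inv = σ , ⇓while-false (counter 0 σ inv) , inv
  countdown (suc k) σ inv =
    let τ , run , inv′ = body k σ inv
        υ , rest , inv″ = countdown k τ inv′
    in υ , ⇓while-true (λ ≡0 → 0≢1+n (trans (sym ≡0) (counter (suc k) σ inv))) run rest , inv″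

-- A language of bounded sums, in de Bruijn notation.  A summation variable ranges
-- over the numbers below cell 0 of array 0; truncated subtraction supplies all
-- Boolean connectives.

infixl 6 _⊞_ _⊟_

data Term (k : ℕ) : Set where
  var     : Fin k → Term k
  num     : ℕ → Term k
  cell    : Fin 3 → Term k → Term k
  _⊞_ _⊟_ : Term k → Term k → Term k
  ∑       : Term (suc k) → Term k

⟦_⟧ : ∀ {k} → Term k → Store → Vec ℕ k → ℕ
⟦ var i ⟧    M ρ = lookup ρ i
⟦ num c ⟧    M ρ = c
⟦ cell b t ⟧ M ρ = M (toℕ b) (⟦ t ⟧ M ρ)
⟦ s ⊞ t ⟧    M ρ = ⟦ s ⟧ M ρ + ⟦ t ⟧ M ρ
⟦ s ⊟ t ⟧    M ρ = ⟦ s ⟧ M ρ ∸ ⟦ t ⟧ M ρ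
⟦ ∑ t ⟧      M ρ = sum λ (i : Fin (M 0 0)) → ⟦ t ⟧ M (toℕ i ∷ ρ)

-- compile xs a t leaves the value of t in cell 0 of array a; the variables are
-- read from cell 0 of the arrays xs, and the arrays below a are preserved.

compile : ∀ {k} → Vec ℕ k → ℕ → Term k → Program
compile xs a (var i)    = a [ const 0 ]≔ lookup xs i [ const 0 ]
compile xs a (num c)    = a [ const 0 ]≔ const c
compile xs a (cell b t) = compile xs a t ⨾ a [ const 0 ]≔ toℕ b [ a [ const 0 ] ]
compile xs a (s ⊞ t)    = compile xs a s ⨾ compile xs (suc a) t ⨾
  a [ const 0 ]≔ a [ const 0 ] ⊕ suc a [ const 0 ]
compile xs a (s ⊟ t)    = compile xs a s ⨾ compile xs (suc a) t ⨾
  a [ const 0 ]≔ a [ const 0 ] ⊖ suc a [ const 0 ]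
compile xs a (∑ t)      =
  a [ const 0 ]≔ const 0 ⨾
  suc a [ const 0 ]≔ 0 [ const 0 ] ⨾
  while (suc a [ const 0 ])
    (suc a [ const 0 ]≔ suc a [ const 0 ] ⊖ const 1 ⨾
     compile (suc a ∷ xs) (2 + a) t ⨾
     a [ const 0 ]≔ a [ const 0 ] ⊕ (2 + a) [ const 0 ])

-- Exact rather than an upper bound: compiled code branches only on loop counters, so its time
-- depends on `n` alone.
time : ∀ {k} → Term k → ℕ → ℕ
time (var i)    n = 4
time (num c)    n = 3
time (cell b t) n = time t n + 5
time (s ⊞ t)    n = time s n + (time t n + 7)
time (s ⊟ t)    n = time s n + (time t n + 7)
time (∑ t)      n = 3 + (4 + loopTime (6 + (time t n + 7)) n)

-- Correctness of compilation

-- The compiled loop counts down and so consumes the largest index first, whereas `sum` unfolds from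
-- the smallest.
sum-snoc : ∀ k (f : ℕ → ℕ) → sum {suc k} (f ∘ toℕ) ≡ f k + sum {k} (f ∘ toℕ)
sum-snoc k f = begin
  sum {suc k} (f ∘ toℕ)
    ≡⟨ sum-init-last {k} (f ∘ toℕ) ⟩
  sum {k} (f ∘ toℕ ∘ Fin.inject₁) + f (toℕ (Fin.fromℕ k))
    ≡⟨ cong₂ _+_ (sum-cong-≗ {k} (cong f ∘ toℕ-inject₁)) (cong f (toℕ-fromℕ k)) ⟩
  sum {k} (f ∘ toℕ) + f k
    ≡⟨ +-comm _ (f k) ⟩
  f k + sum {k} (f ∘ toℕ) ∎
  where open ≡-Reasoning

-- Terms are evaluated against a fixed `M`, of which only arrays 0 to 2 matter; `3≤a` places all
-- scratch arrays beyond them.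
record Represents {k} (M : Store) (xs : Vec ℕ k) (ρ : Vec ℕ k) (a : ℕ) (σ : Store) : Set where
  field
    memory : AgreeBelow 3 M σ
    3≤a    : 3 ≤ a
    names  : ∀ i → lookup xs i < a
    values : ∀ i → σ (lookup xs i) 0 ≡ lookup ρ i

represents-mono : ∀ {k M a b σ τ} {xs ρ : Vec ℕ k} → a ≤ b → AgreeBelow a σ τ →
  Represents M xs ρ a σ → Represents M xs ρ b τ
represents-mono a≤b σ≈τ R = record
  { memory = agree-trans 3≤a memory σ≈τ
  ; 3≤a    = ≤-trans 3≤a a≤b
  ; names  = λ i → <-≤-trans (names i) a≤b
  ; values = λ i → trans (σ≈τ _ 0 (names i)) (values i)
  } where open Represents R

represents-push : ∀ {k M a σ x} {xs ρ : Vec ℕ k} → σ a 0 ≡ x →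
  Represents M xs ρ a σ → Represents M (a ∷ xs) (x ∷ ρ) (suc a) σ
represents-push {a = a} σa≡x R = record
  { memory = memory
  ; 3≤a    = m≤n⇒m≤1+n 3≤a
  ; names  = λ { zero → n<1+n a ; (suc i) → m<n⇒m<1+n (names i) }
  ; values = λ { zero → σa≡x ; (suc i) → values i }
  } where open Represents R

Computes : Program → Store → ℕ → ℕ → ℕ → Set
Computes P σ t a v = ∃ λ τ → (⟨ P , σ ⟩⇓[ t ] τ) × τ a 0 ≡ v × AgreeBelow a σ τ

-- By induction on the term. A value parked in array `a` survives the evaluation of a second
-- operand, which works from `suc a` upwards.
compile-correct : ∀ {k M a σ} {xs ρ : Vec ℕ k} (t : Term k) → Represents M xs ρ a σ →
  Computes (compile xs a t) σ (time t (M 0 0)) a (⟦ t ⟧ M ρ)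


compile-correct {a = a} {σ} (var i) R =
  _ , ⇓assign , trans (update-self σ a _) (values i) , agree-update σ a 0 _
  where open Represents R
compile-correct {a = a} {σ} (num c) R =
  _ , ⇓assign , update-self σ a _ , agree-update σ a 0 _
compile-correct {a = a} {σ} (cell b t) R =
  let τ , run , τa≡ , σ≈τ = compile-correct t R in
  _ , ⇓seq run ⇓assign ,
  trans (update-self τ a _) (trans (cong (τ (toℕ b)) τa≡)
    (trans (σ≈τ (toℕ b) _ (<-≤-trans (toℕ<n b) 3≤a)) (memory (toℕ b) _ (toℕ<n b)))) ,
  agree-trans ≤-refl σ≈τ (agree-update τ a 0 _)
  where open Represents R
compile-correct {a = a} {σ} (s ⊞ t) R =
  let τ , run , τa≡ , σ≈τ = compile-correct s R
      υ , run′ , υa≡ , τ≈υ = compile-correct t (represents-mono (n≤1+n a) σ≈τ R)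
  in _ , ⇓seq run (⇓seq run′ ⇓assign) ,
  trans (update-self υ a _) (cong₂ _+_ (trans (τ≈υ a 0 (n<1+n a)) τa≡) υa≡) ,
  agree-trans ≤-refl (agree-trans (n≤1+n a) σ≈τ τ≈υ) (agree-update υ a 0 _)
compile-correct {a = a} {σ} (s ⊟ t) R =
  let τ , run , τa≡ , σ≈τ = compile-correct s R
      υ , run′ , υa≡ , τ≈υ = compile-correct t (represents-mono (n≤1+n a) σ≈τ R)
  in _ , ⇓seq run (⇓seq run′ ⇓assign) ,
  trans (update-self υ a _) (cong₂ _∸_ (trans (τ≈υ a 0 (n<1+n a)) τa≡) υa≡) ,
  agree-trans ≤-refl (agree-trans (n≤1+n a) σ≈τ τ≈υ) (agree-update υ a 0 _)
compile-correct {k} {M} {a} {σ} {xs} {ρ} (∑ t) R =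
  let τ , run , τa≡ , _ , σ≈τ = countdown Inv (λ _ _ (_ , p , _) → p) iteration n σ₂
        ( cong (_+ sum {n} (f ∘ toℕ)) σ₂a≡0
        , trans (update-self σ₁ (suc a) _) (trans (update-other σ 0 0 0 (>⇒≢ 0<a)) (memory 0 0 z<s))
        , agree-trans (n≤1+n a) (agree-update σ a 0 0) (agree-update σ₁ (suc a) 0 _))
  in τ , ⇓seq ⇓assign (⇓seq ⇓assign run) , trans (sym (+-identityʳ _)) τa≡ , σ≈τ
  where
  open Represents R
  n = M 0 0
  f = λ i → ⟦ t ⟧ M (i ∷ ρ)
  0<a : 0 < a
  0<a = <-≤-trans z<s 3≤a
  σ₁ = σ [ a , 0 ↦ 0 ]
  σ₂ = σ₁ [ suc a , 0 ↦ σ₁ 0 0 ]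
  σ₂a≡0 : σ₂ a 0 ≡ 0
  σ₂a≡0 = trans (update-other σ₁ 0 _ 0 1+n≢n) (update-self σ a 0)
  -- The accumulator plus the summands still to come is constant.
  Inv : ℕ → Store → Set
  Inv j τ = τ a 0 + sum {j} (f ∘ toℕ) ≡ sum {n} (f ∘ toℕ) × τ (suc a) 0 ≡ j × AgreeBelow a σ τ
  iteration : ∀ j τ → Inv (suc j) τ → ∃ λ υ → (⟨ _ , τ ⟩⇓[ 6 + (time t n + 7) ] υ) × Inv j υ
  iteration j τ (acc , ctr , σ≈τ) =
    -- Decrementing before the body makes the counter run through n - 1, ..., 0, so its cell serves
    -- as the summation variable itself.
    let τ₁ = τ [ suc a , 0 ↦ τ (suc a) 0 ∸ 1 ]
        τ≈τ₁ = agree-update τ (suc a) 0 (τ (suc a) 0 ∸ 1)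
        τ₁ctr : τ₁ (suc a) 0 ≡ j
        τ₁ctr = trans (update-self τ (suc a) _) (cong (_∸ 1) ctr)
        R₁ = represents-mono (n≤1+n a) (agree-trans (n≤1+n a) σ≈τ τ≈τ₁) R
        τ₂ , run , τ₂≡ , τ₁≈τ₂ = compile-correct t (represents-push τ₁ctr R₁)
        υ = τ₂ [ a , 0 ↦ τ₂ a 0 + τ₂ (2 + a) 0 ]
        τ₂a≡ = trans (τ₁≈τ₂ a 0 (m<n⇒m<1+n (n<1+n a))) (τ≈τ₁ a 0 (n<1+n a))
    in υ , ⇓seq ⇓assign (⇓seq run ⇓assign) ,
       ( (begin
            υ a 0 + sum {j} (f ∘ toℕ)             ≡⟨ cong (_+ sum {j} (f ∘ toℕ)) (update-self τ₂ a _) ⟩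
            τ₂ a 0 + τ₂ (2 + a) 0 + sum {j} (f ∘ toℕ)     ≡⟨ cong₂ (λ x y → x + y + sum {j} (f ∘ toℕ)) τ₂a≡ τ₂≡ ⟩
            τ a 0 + f j + sum {j} (f ∘ toℕ)       ≡⟨ +-assoc (τ a 0) _ _ ⟩
            τ a 0 + (f j + sum {j} (f ∘ toℕ))     ≡⟨ cong (τ a 0 +_) (sum-snoc j f) ⟨
            τ a 0 + sum {suc j} (f ∘ toℕ)         ≡⟨ acc ⟩
            sum {n} (f ∘ toℕ) ∎)
       , trans (update-other τ₂ 0 _ 0 (1+n≢n ∘ sym)) (trans (τ₁≈τ₂ (suc a) 0 ≤-refl) τ₁ctr)
       , agree-trans ≤-refl (agree-trans (≤-trans (n≤1+n a) (n≤1+n _)) (agree-trans (n≤1+n a) σ≈τ τ≈τ₁) τ₁≈τ₂) (agree-update τ₂ a 0 _))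
    where open ≡-Reasoning

-- Greedy multicover

sum-mono : ∀ {n} {f g : Fin n → ℕ} → (∀ i → f i ≤ g i) → sum f ≤ sum g
sum-mono {zero}  f≤g = z≤n
sum-mono {suc n} f≤g = +-mono-≤ (f≤g zero) (sum-mono (f≤g ∘ suc))

sum-const : ∀ n c → sum {n} (λ _ → c) ≡ n * c
sum-const zero    c = refl
sum-const (suc n) c = cong (c +_) (sum-const n c)

sum-zero : ∀ {n} {f : Fin n → ℕ} → (∀ i → f i ≡ 0) → sum f ≡ 0
sum-zero {n} {f} f≗0 = trans (sum-cong-≗ {n} {f} {λ _ → 0} f≗0) (trans (sum-const n 0) (*-zeroʳ n))

term≤sum : ∀ {n} (f : Fin n → ℕ) i → f i ≤ sum f
term≤sum f zero    = m≤m+n _ _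
term≤sum f (suc i) = ≤-trans (term≤sum (f ∘ suc) i) (m≤n+m _ (f zero))

-- The head of the tuple is the innermost sum, matching `∑*`, where variable 0 is bound innermost.
sums : ∀ k {n} → (Vec (Fin n) k → ℕ) → ℕ
sums zero    f = f []
sums (suc k) f = sums k λ q → sum λ i → f (i ∷ q)

sums-mono : ∀ k {n} {f g : Vec (Fin n) k → ℕ} → (∀ q → f q ≤ g q) → sums k f ≤ sums k g
sums-mono zero    f≤g = f≤g []
sums-mono (suc k) f≤g = sums-mono k λ q → sum-mono λ i → f≤g (i ∷ q)

sums-cong : ∀ k {n} {f g : Vec (Fin n) k → ℕ} → (∀ q → f q ≡ g q) → sums k f ≡ sums k g
sums-cong zero    f≗g = f≗g []
sums-cong (suc k) f≗g = sums-cong k λ q → sum-cong-≗ λ i → f≗g (i ∷ q)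

sums-+ : ∀ k {n} (f g : Vec (Fin n) k → ℕ) → sums k (λ q → f q + g q) ≡ sums k f + sums k g
sums-+ zero    f g = refl
sums-+ (suc k) f g = trans (sums-cong k λ q → ∑-distrib-+ (λ i → f (i ∷ q)) (λ i → g (i ∷ q))) (sums-+ k _ _)

sums-* : ∀ k {n} c (f : Vec (Fin n) k → ℕ) → c * sums k f ≡ sums k (λ q → c * f q)
sums-* zero    c f = refl
sums-* (suc k) c f = trans (sums-* k c _) (sums-cong k λ q → *-distribˡ-sum c λ i → f (i ∷ q))

sums-comm : ∀ k {n m} (f : Vec (Fin n) k → Fin m → ℕ) →
  sums k (λ q → sum (f q)) ≡ sum λ j → sums k λ q → f q j
sums-comm zero    f = refl
sums-comm (suc k) f = trans (sums-cong k λ q → ∑-comm λ i j → f (i ∷ q) j)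
  (sums-comm k λ q j → sum λ i → f (i ∷ q) j)

sums-const : ∀ k n c → sums k {n} (λ _ → c) ≡ n ^ k * c
sums-const zero    n c = sym (*-identityˡ c)
sums-const (suc k) n c = begin
  sums k {n} (λ _ → sum {n} (λ _ → c))  ≡⟨ sums-cong k {n} (λ _ → sum-const n c) ⟩
  sums k {n} (λ _ → n * c)              ≡⟨ sums-const k n (n * c) ⟩
  n ^ k * (n * c)                       ≡⟨ *-assoc (n ^ k) n c ⟨
  n ^ k * n * c                         ≡⟨ cong (_* c) (*-comm (n ^ k) n) ⟩
  n * n ^ k * c                         ∎
  where open ≡-Reasoning

term≤sums : ∀ k {n} (f : Vec (Fin n) k → ℕ) q → f q ≤ sums k f
term≤sums zero    f []      = ≤-refl
term≤sums (suc k) f (i ∷ q) = ≤-trans (term≤sum _ i) (term≤sums k _ q)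

-- A product weight makes the sum over all tuples factor into a power, which is how the tuples hit
-- by a vertex are counted.
weight : ∀ {n k} → (Fin n → ℕ) → Vec (Fin n) k → ℕ
weight W []      = 1
weight W (i ∷ q) = W i * weight W q

sums-weight : ∀ k {n} (W : Fin n → ℕ) → sums k (weight W) ≡ sum W ^ k
sums-weight zero    W = refl
sums-weight (suc k) W = begin
  sums k (λ q → sum λ i → W i * weight W q)  ≡⟨ sums-cong k (λ q → *-distribʳ-sum (weight W q) W) ⟨
  sums k (λ q → sum W * weight W q)          ≡⟨ sums-* k (sum W) (weight W) ⟨
  sum W * sums k (weight W)                  ≡⟨ cong (sum W *_) (sums-weight k W) ⟩
  sum W * sum W ^ k                          ∎
  where open ≡-Reasoning

𝟙 : Bool → ℕ
𝟙 false = 0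
𝟙 true  = 1

𝟙≤1 : ∀ b → 𝟙 b ≤ 1
𝟙≤1 false = z≤n
𝟙≤1 true  = ≤-refl

sum-pick : ∀ {n} (v : Fin n) (g : Fin n → ℕ) → sum (λ u → 𝟙 (toℕ v ≡ᵇ toℕ u) * g u) ≡ g v
sum-pick {suc n} zero g =
  trans (cong (g zero + 0 +_) (trans (sum-const n 0) (*-zeroʳ n))) (trans (+-identityʳ _) (+-identityʳ _))
sum-pick (suc v) g = sum-pick v (g ∘ suc)

size : ∀ {n} → (Fin n → Bool) → ℕ
size L = sum (𝟙 ∘ L)

-- The inserted vertex is a bare number, since terms and programs know vertices only as numbers.
insert : ∀ {n} → ℕ → (Fin n → Bool) → (Fin n → Bool)
insert v L u = (v ≡ᵇ toℕ u) ∨ L u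

size-insert : ∀ {n} (v : Fin n) (L : Fin n → Bool) → size (insert (toℕ v) L) ≤ suc (size L)
size-insert {n} v L = begin
  size (insert (toℕ v) L)
    ≤⟨ sum-mono (λ u → bound (toℕ v ≡ᵇ toℕ u) (L u)) ⟩
  sum {n} (λ u → 𝟙 (toℕ v ≡ᵇ toℕ u) * 1 + 𝟙 (L u))
    ≡⟨ ∑-distrib-+ {n} (λ u → 𝟙 (toℕ v ≡ᵇ toℕ u) * 1) (𝟙 ∘ L) ⟩
  sum {n} (λ u → 𝟙 (toℕ v ≡ᵇ toℕ u) * 1) + size L
    ≡⟨ cong (_+ size L) (sum-pick v (λ _ → 1)) ⟩
  suc (size L) ∎
  where
  open ≤-Reasoning
  bound : ∀ e l → 𝟙 (e ∨ l) ≤ 𝟙 e * 1 + 𝟙 l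
  bound false l = ≤-refl
  bound true  l = m≤m+n 1 (𝟙 l)

-- Constraint q asks for at least req q members of C q.

module Multicover {n k : ℕ} (C : Vec (Fin n) k → Fin n → Bool) (req : Vec (Fin n) k → ℕ) where

  cov : (Fin n → Bool) → Vec (Fin n) k → ℕ
  cov L q = sum λ u → 𝟙 (C q u ∧ L u)

  Cover : (Fin n → Bool) → Set
  Cover L = ∀ q → req q ≤ cov L q

  potential : (Fin n → Bool) → ℕ
  potential L = sums k λ q → req q ∸ cov L q

  potential-cong : ∀ {L L′} → (∀ u → L u ≡ L′ u) → potential L ≡ potential L′
  potential-cong L≗L′ = sums-cong k λ q →
    cong (req q ∸_) (sum-cong-≗ λ u → cong (λ b → 𝟙 (C q u ∧ b)) (L≗L′ u))

  potential≡0⇒cover : ∀ L → potential L ≡ 0 → Cover L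
  potential≡0⇒cover L Φ≡0 q =
    m∸n≡0⇒m≤n (n≤0⇒n≡0 (≤-trans (term≤sums k (λ q → req q ∸ cov L q) q) (≤-reflexive Φ≡0)))

  fresh : (Fin n → Bool) → Vec (Fin n) k → Fin n → ℕ
  fresh L q v = 𝟙 (C q v ∧ not (L v))

  cov-insert : ∀ L q v → cov (insert (toℕ v) L) q ≡ cov L q + fresh L q v
  cov-insert L q v = begin
    cov (insert (toℕ v) L) q
      ≡⟨ sum-cong-≗ (λ u → split (C q u) (toℕ v ≡ᵇ toℕ u) (L u)) ⟩
    sum (λ u → 𝟙 (C q u ∧ L u) + 𝟙 (toℕ v ≡ᵇ toℕ u) * fresh L q u)
      ≡⟨ ∑-distrib-+ (λ u → 𝟙 (C q u ∧ L u)) (λ u → 𝟙 (toℕ v ≡ᵇ toℕ u) * fresh L q u) ⟩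
    cov L q + sum (λ u → 𝟙 (toℕ v ≡ᵇ toℕ u) * fresh L q u)
      ≡⟨ cong (cov L q +_) (sum-pick v (fresh L q)) ⟩
    cov L q + fresh L q v ∎
    where
    open ≡-Reasoning
    split : ∀ c e l → 𝟙 (c ∧ (e ∨ l)) ≡ 𝟙 (c ∧ l) + 𝟙 e * 𝟙 (c ∧ not l)
    split false false l     = refl
    split false true  l     = refl
    split true  false l     = sym (+-identityʳ (𝟙 l))
    split true  true  false = refl
    split true  true  true  = refl

  -- If demand remains, at least `req q ∸ cov L q` members of `L*` are fresh for `q`, and inserting
  -- any one of them lowers the residual by exactly 1. The additive form avoids truncated
  -- differences.
  residual-average : ∀ L L* q → req q ≤ cov L* q →
    req q ∸ cov L q + sum (λ v → 𝟙 (L* v) * (req q ∸ cov (insert (toℕ v) L) q)) ≤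
    sum (λ v → 𝟙 (L* v) * (req q ∸ cov L q))
  residual-average L L* q r≤ with req q ≤? c
    where c = cov L q
  ... | yes r≤c rewrite m≤n⇒m∸n≡0 r≤c = sum-mono λ v → *-monoʳ-≤ (𝟙 (L* v)) $ begin
    req q ∸ cov (insert (toℕ v) L) q    ≡⟨ cong (req q ∸_) (cov-insert L q v) ⟩
    req q ∸ (cov L q + fresh L q v)     ≡⟨ m≤n⇒m∸n≡0 (m≤n⇒m≤n+o (fresh L q v) r≤c) ⟩
    0                                   ∎
    where open ≤-Reasoning
  ... | no r≰c = begin
    r ∸ c + sum (λ v → 𝟙 (L* v) * (r ∸ cov (insert (toℕ v) L) q))
      ≤⟨ +-monoˡ-≤ _ (m≤n+o⇒m∸n≤o r c (≤-trans r≤ new)) ⟩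
    sum (λ v → 𝟙 (L* v) * fresh L q v) + sum (λ v → 𝟙 (L* v) * (r ∸ cov (insert (toℕ v) L) q))
      ≡⟨ ∑-distrib-+ (λ v → 𝟙 (L* v) * fresh L q v) _ ⟨
    sum (λ v → 𝟙 (L* v) * fresh L q v + 𝟙 (L* v) * (r ∸ cov (insert (toℕ v) L) q))
      ≡⟨ sum-cong-≗ gain ⟩
    sum (λ v → 𝟙 (L* v) * (r ∸ c)) ∎
    where
    open ≤-Reasoning
    r = req q
    c = cov L q
    -- A member of `L*` in `C q` either lies in `L` already or is fresh.
    new : cov L* q ≤ c + sum (λ v → 𝟙 (L* v) * fresh L q v)
    new = begin
      cov L* q
        ≤⟨ sum-mono (λ v → split (C q v) (L* v) (L v)) ⟩
      sum (λ v → 𝟙 (C q v ∧ L v) + 𝟙 (L* v) * fresh L q v)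
        ≡⟨ ∑-distrib-+ (λ v → 𝟙 (C q v ∧ L v)) _ ⟩
      c + sum (λ v → 𝟙 (L* v) * fresh L q v) ∎
      where
      split : ∀ c l* l → 𝟙 (c ∧ l*) ≤ 𝟙 (c ∧ l) + 𝟙 l* * 𝟙 (c ∧ not l)
      split false l*    l     = z≤n
      split true  false l     = z≤n
      split true  true  false = ≤-refl
      split true  true  true  = ≤-refl
    gain : ∀ v → 𝟙 (L* v) * fresh L q v + 𝟙 (L* v) * (r ∸ cov (insert (toℕ v) L) q) ≡ 𝟙 (L* v) * (r ∸ c)
    gain v = begin-equality
      𝟙 (L* v) * δ + 𝟙 (L* v) * (r ∸ cov (insert (toℕ v) L) q)
        ≡⟨ *-distribˡ-+ (𝟙 (L* v)) δ _ ⟨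
      𝟙 (L* v) * (δ + (r ∸ cov (insert (toℕ v) L) q))
        ≡⟨ cong (λ x → 𝟙 (L* v) * (δ + x)) (trans (cong (r ∸_) (cov-insert L q v)) (sym (∸-+-assoc r c δ))) ⟩
      𝟙 (L* v) * (δ + (r ∸ c ∸ δ))
        -- Here the residual is at least 1 and δ at most 1, so nothing is truncated.
        ≡⟨ cong (𝟙 (L* v) *_) (m+[n∸m]≡n (≤-trans (𝟙≤1 (C q v ∧ not (L v))) (m<n⇒0<n∸m (≰⇒> r≰c)))) ⟩
      𝟙 (L* v) * (r ∸ c) ∎
      where δ = fresh L q v

  -- `residual-average` summed over all constraints, with the two sums exchanged: the gains of the
  -- members of `L*` add up to at least the whole potential.
  average : ∀ L L* → Cover L* →
    potential L + sum (λ v → 𝟙 (L* v) * potential (insert (toℕ v) L)) ≤ sum (λ v → 𝟙 (L* v) * potential L)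
  average L L* cover = begin
    potential L + sum (λ v → 𝟙 (L* v) * potential (insert (toℕ v) L))
      ≡⟨ cong (potential L +_) (pull λ v q → req q ∸ cov (insert (toℕ v) L) q) ⟩
    potential L + sums k (λ q → sum λ v → 𝟙 (L* v) * (req q ∸ cov (insert (toℕ v) L) q))
      ≡⟨ sums-+ k _ _ ⟨
    sums k (λ q → req q ∸ cov L q + sum (λ v → 𝟙 (L* v) * (req q ∸ cov (insert (toℕ v) L) q)))
      ≤⟨ sums-mono k (λ q → residual-average L L* q (cover q)) ⟩
    sums k (λ q → sum λ v → 𝟙 (L* v) * (req q ∸ cov L q))
      ≡⟨ pull (λ v q → req q ∸ cov L q) ⟨
    sum (λ v → 𝟙 (L* v) * potential L) ∎
    where
    open ≤-Reasoning
    pull : ∀ (f : Fin n → Vec (Fin n) k → ℕ) →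
      sum (λ v → 𝟙 (L* v) * sums k (f v)) ≡ sums k (λ q → sum λ v → 𝟙 (L* v) * f v q)
    pull f = trans (sum-cong-≗ λ v → sums-* k (𝟙 (L* v)) (f v)) (sym (sums-comm k λ q v → 𝟙 (L* v) * f v q))

  -- The minimum with `req q` discards vacuous tuples, which would make the count depend on `n`.
  hits : Fin n → ℕ
  hits v = sums k λ q → 𝟙 (C q v) ⊓ req q

  -- An insertion raises the coverage of `q` by at most 1, and only if `v` lies in `C q`.
  gain≤hits : ∀ L v → potential L ≤ potential (insert (toℕ v) L) + hits v
  gain≤hits L v = begin
    potential L
      ≤⟨ sums-mono k pointwise ⟩
    sums k (λ q → (req q ∸ cov (insert (toℕ v) L) q) + 𝟙 (C q v) ⊓ req q)
      ≡⟨ sums-+ k _ _ ⟩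
    potential (insert (toℕ v) L) + hits v ∎
    where
    open ≤-Reasoning
    fresh≤ : ∀ c l → 𝟙 (c ∧ not l) ≤ 𝟙 c
    fresh≤ false l     = z≤n
    fresh≤ true  false = ≤-refl
    fresh≤ true  true  = z≤n
    pointwise : ∀ q → req q ∸ cov L q ≤ (req q ∸ cov (insert (toℕ v) L) q) + 𝟙 (C q v) ⊓ req q
    pointwise q = begin
      r ∸ c                              ≤⟨ ⊓-glb (≤-trans (m≤n+m∸n (r ∸ c) δ) (≤-reflexive (+-comm δ _)))
                                                  (≤-trans (m∸n≤m r c) (m≤n+m r _)) ⟩
      ((r ∸ c ∸ δ) + δ) ⊓ ((r ∸ c ∸ δ) + r)  ≡⟨ +-distribˡ-⊓ (r ∸ c ∸ δ) δ r ⟨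
      (r ∸ c ∸ δ) + δ ⊓ r                ≤⟨ +-monoʳ-≤ (r ∸ c ∸ δ) (⊓-monoˡ-≤ r (fresh≤ (C q v) (L v))) ⟩
      (r ∸ c ∸ δ) + 𝟙 (C q v) ⊓ r        ≡⟨ cong (_+ 𝟙 (C q v) ⊓ r) (trans (∸-+-assoc r c δ) (cong (r ∸_) (sym (cov-insert L q v)))) ⟩
      (r ∸ cov (insert (toℕ v) L) q) + 𝟙 (C q v) ⊓ r ∎
      where
      r = req q
      c = cov L q
      δ = fresh L q v

  -- By `average` the potential is at most the total gain of the members of `L*`, and each gain is
  -- at most `D`. Applied to the empty set, this bounds the starting potential.
  potential≤ : ∀ {D} → (∀ v → hits v ≤ D) → ∀ L L* → Cover L* → potential L ≤ size L* * D
  potential≤ {D} hits≤D L L* cover = +-cancelʳ-≤ X _ _ $ begin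
    potential L + X                                                  ≤⟨ average L L* cover ⟩
    sum (λ v → 𝟙 (L* v) * potential L)                               ≤⟨ sum-mono (λ v → *-monoʳ-≤ (𝟙 (L* v))
                                                                          (≤-trans (gain≤hits L v) (+-monoʳ-≤ (Ψ v) (hits≤D v)))) ⟩
    sum (λ v → 𝟙 (L* v) * (Ψ v + D))                                 ≡⟨ sum-cong-≗ (λ v → trans (*-distribˡ-+ (𝟙 (L* v)) (Ψ v) D) (+-comm (𝟙 (L* v) * Ψ v) _)) ⟩
    sum (λ v → 𝟙 (L* v) * D + 𝟙 (L* v) * Ψ v)                        ≡⟨ ∑-distrib-+ (λ v → 𝟙 (L* v) * D) _ ⟩
    sum (λ v → 𝟙 (L* v) * D) + X                                     ≡⟨ cong (_+ X) (*-distribʳ-sum D (𝟙 ∘ L*)) ⟨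
    size L* * D + X                                                  ∎
    where
    open ≤-Reasoning
    Ψ = λ v → potential (insert (toℕ v) L)
    X = sum λ v → 𝟙 (L* v) * Ψ v

  -- The number of rounds is fixed in advance, so rounds after the potential has vanished must be
  -- idle; the first alternative records this.
  GreedyStep : (Fin n → Bool) → (Fin n → Bool) → Set
  GreedyStep L L′ =
    (potential L ≡ 0 × (∀ u → L′ u ≡ L u)) ⊎
    (potential L ≢ 0 × ∃ λ (b : Fin n) → (∀ (v : Fin n) → potential (insert (toℕ b) L) ≤ potential (insert (toℕ v) L)) ×
             (∀ u → L′ u ≡ insert (toℕ b) L u))

  -- The best vertex does at least as well as each member of `L*`, so `average` applies. This is Φ′
  -- ≤ (1 - 1/m) Φ without division, where m is the size of `L*`.
  step-progress : ∀ {L L′ L*} → Cover L* → GreedyStep L L′ →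
    size L* * potential L′ + potential L ≤ size L* * potential L
  step-progress {L} {L′} {L*} cover (inj₁ (Φ≡0 , L′≗L)) = begin
    size L* * potential L′ + potential L  ≡⟨ cong₂ (λ x y → size L* * x + y) (potential-cong L′≗L) Φ≡0 ⟩
    size L* * potential L + 0             ≡⟨ +-identityʳ _ ⟩
    size L* * potential L                 ∎
    where open ≤-Reasoning
  step-progress {L} {L′} {L*} cover (inj₂ (_ , b , b-min , L′≗)) = begin
    size L* * potential L′ + potential L
      ≡⟨ cong (_+ potential L) (*-distribʳ-sum (potential L′) (𝟙 ∘ L*)) ⟩
    sum (λ v → 𝟙 (L* v) * potential L′) + potential L
      ≤⟨ +-monoˡ-≤ (potential L) (sum-mono λ v → *-monoʳ-≤ (𝟙 (L* v)) (≤-trans (≤-reflexive (potential-cong L′≗)) (b-min v))) ⟩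
    sum (λ v → 𝟙 (L* v) * potential (insert (toℕ v) L)) + potential L
      ≡⟨ +-comm _ (potential L) ⟩
    potential L + sum (λ v → 𝟙 (L* v) * potential (insert (toℕ v) L))
      ≤⟨ average L L* cover ⟩
    sum (λ v → 𝟙 (L* v) * potential L)
      ≡⟨ *-distribʳ-sum (potential L) (𝟙 ∘ L*) ⟨
    size L* * potential L ∎
    where open ≤-Reasoning

  step-size : ∀ {L L′} → GreedyStep L L′ → size L′ ≤ suc (size L)
  step-size (inj₁ (_ , L′≗L)) = m≤n⇒m≤1+n (≤-reflexive (sum-cong-≗ (cong 𝟙 ∘ L′≗L)))
  step-size {L} (inj₂ (_ , b , _ , L′≗)) = ≤-trans (≤-reflexive (sum-cong-≗ (cong 𝟙 ∘ L′≗))) (size-insert b L)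

  step-stop : ∀ {L L′} → potential L ≡ 0 → GreedyStep L L′ → size L′ ≤ size L
  step-stop _   (inj₁ (_ , L′≗L))    = ≤-reflexive (sum-cong-≗ (cong 𝟙 ∘ L′≗L))
  step-stop Φ≡0 (inj₂ (Φ≢0 , _))     = contradiction Φ≡0 Φ≢0

-- Decay of the potential

progress⇒< : ∀ m {x y} .{{_ : NonZero m}} → m * y + x ≤ m * x → y ≤ pred x
progress⇒< m {zero}  {y} p = ≤-reflexive (m*n≡0⇒n≡0 (n≤0⇒n≡0 (≤-trans (m≤m+n _ 0) (≤-trans p (≤-reflexive (*-zeroʳ m))))))
  where
  m*n≡0⇒n≡0 : m * y ≡ 0 → y ≡ 0
  m*n≡0⇒n≡0 eq = *-cancelˡ-≡ y 0 m (trans eq (sym (*-zeroʳ m)))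
progress⇒< m {suc x} {y} p = ≮⇒≥ λ x<y → <⇒≱ (begin-strict
  m * suc x           <⟨ m<m+n (m * suc x) z<s ⟩
  m * suc x + suc x   ≤⟨ +-monoˡ-≤ (suc x) (*-monoʳ-≤ m x<y) ⟩
  m * y + suc x       ∎) p
  where open ≤-Reasoning

module Decay (m : ℕ) (g : ℕ → ℕ) (progress : ∀ t → m * g (suc t) + g t ≤ m * g t) where

  decreases : ∀ t → g (suc t) ≤ pred (g t)
  decreases t with m ≟ 0
  -- For m = 0 the progress inequality one step later reads g (suc t) ≤ 0.
  ... | yes refl = ≤-trans (progress (suc t)) z≤n
  ... | no  m≢0  = progress⇒< m {{≢-nonZero m≢0}} (progress t)

  descend : ∀ i t → g (i + t) ≤ g t ∸ i
  descend zero    t = ≤-refl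
  descend (suc i) t = begin
    g (suc (i + t))     ≤⟨ decreases (i + t) ⟩
    pred (g (i + t))    ≤⟨ pred-mono-≤ (descend i t) ⟩
    pred (g t ∸ i)      ≡⟨ pred[m∸n]≡m∸[1+n] (g t) i ⟩
    g t ∸ suc i         ∎
    where open ≤-Reasoning

  vanished : ∀ {t} i → g t ≡ 0 → g (i + t) ≡ 0
  vanished {t} i g≡0 = n≤0⇒n≡0 (≤-trans (descend i t) (≤-trans (m∸n≤m (g t) i) (≤-reflexive g≡0)))

  -- Throughout the `i` steps the value is at least the final one, so every step loses at least an
  -- m-th part of the final value.
  spread : ∀ t i → m * g (i + t) + i * g (i + t) ≤ m * g t
  spread t zero    = ≤-reflexive (+-identityʳ _)
  spread t (suc i) = begin
    m * y + (y + i * y)  ≤⟨ +-monoʳ-≤ (m * y) (+-mono-≤ y≤x (*-monoʳ-≤ i y≤x)) ⟩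
    m * y + (x + i * x)  ≡⟨ +-assoc (m * y) x _ ⟨
    m * y + x + i * x    ≤⟨ +-monoˡ-≤ (i * x) (progress (i + t)) ⟩
    m * x + i * x        ≤⟨ spread t i ⟩
    m * g t              ∎
    where
    open ≤-Reasoning
    x = g (i + t)
    y = g (suc i + t)
    y≤x : y ≤ x
    y≤x = ≤-trans (decreases (i + t)) pred[n]≤n

  -- `spread` over m steps; no estimate of (1 - 1/m)^m is involved.
  halve : .{{_ : NonZero m}} → ∀ t → 2 * g (m + t) ≤ g t
  halve t = *-cancelˡ-≤ m $ begin
    m * (2 * y)    ≡⟨ cong (λ z → m * (y + z)) (+-identityʳ y) ⟩
    m * (y + y)    ≡⟨ *-distribˡ-+ m y y ⟩
    m * y + m * y  ≤⟨ spread t m ⟩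
    m * g t        ∎
    where
    open ≤-Reasoning
    y = g (m + t)

  halve-iter : .{{_ : NonZero m}} → ∀ j → 2 ^ j * g (j * m) ≤ g 0
  halve-iter zero    = ≤-reflexive (+-identityʳ _)
  halve-iter (suc j) = begin
    2 * 2 ^ j * g (m + j * m)    ≡⟨ cong (_* g (m + j * m)) (*-comm 2 (2 ^ j)) ⟩
    2 ^ j * 2 * g (m + j * m)    ≡⟨ *-assoc (2 ^ j) 2 _ ⟩
    2 ^ j * (2 * g (m + j * m))  ≤⟨ *-monoʳ-≤ (2 ^ j) (halve (j * m)) ⟩
    2 ^ j * g (j * m)            ≤⟨ halve-iter j ⟩
    g 0                          ∎
    where open ≤-Reasoning

  -- After `j` halvings of m steps each, at most m is left, and m further steps lose at least 1 each
  -- until 0.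
  vanish : ∀ j → g 0 ≤ m * 2 ^ j → g (suc j * m) ≡ 0
  vanish j g₀≤ with m ≟ 0
  ... | yes refl = n≤0⇒n≡0 (progress (j * 0))
  ... | no  m≢0  = n≤0⇒n≡0 $ begin
    g (m + j * m)    ≤⟨ descend m (j * m) ⟩
    g (j * m) ∸ m    ≡⟨ m≤n⇒m∸n≡0 (*-cancelˡ-≤ (2 ^ j) {{m^n≢0 2 j}} (begin
      2 ^ j * g (j * m)  ≤⟨ halve-iter {{≢-nonZero m≢0}} j ⟩
      g 0                ≤⟨ g₀≤ ⟩
      m * 2 ^ j          ≡⟨ *-comm m (2 ^ j) ⟩
      2 ^ j * m          ∎)) ⟩
    0                ∎
    where open ≤-Reasoning

  -- Here `s` is the size of the chosen set: it grows by at most 1 per step and not at all once `g`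
  -- is 0, however long the process runs on.
  stops : (s : ℕ → ℕ) → s 0 ≡ 0 → (∀ t → s (suc t) ≤ suc (s t)) →
    (∀ t → g t ≡ 0 → s (suc t) ≤ s t) → ∀ T → g T ≡ 0 → ∀ t → s t ≤ T
  stops s s₀ grow stop T gT≡0 = go
    where
    s≤t : ∀ t → s t ≤ t
    s≤t zero    = ≤-reflexive s₀
    s≤t (suc t) = ≤-trans (grow t) (s≤s (s≤t t))
    go : ∀ t → s t ≤ T
    go zero    = ≤-trans (≤-reflexive s₀) z≤n
    go (suc t) with T ≤? t
    ... | yes T≤t = ≤-trans (stop t (subst (λ i → g i ≡ 0) (m∸n+n≡m T≤t) (vanished (t ∸ T) gT≡0))) (go t)
    ... | no  T≰t = ≤-trans (s≤t (suc t)) (≰⇒> T≰t)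

-- The constraints of a graph

infix 7 _==_

_==_ : ∀ {n} → Fin n → Fin n → Bool
u == v = toℕ u ≡ᵇ toℕ v

==-refl : ∀ {n} (u : Fin n) → (u == u) ≡ true
==-refl u = ≡ᵇ-refl (toℕ u)

==⇒≡ : ∀ {n} {u v : Fin n} → (u == v) ≡ true → u ≡ v
==⇒≡ {u = u} {v} eq = toℕ-injective (≡ᵇ⇒≡ (toℕ u) (toℕ v) (subst T (sym eq) _))

≢⇒== : ∀ {n} {u v : Fin n} → u ≢ v → (u == v) ≡ false
≢⇒== u≢v = ≢⇒≡ᵇ-false (u≢v ∘ toℕ-injective)

==-sym : ∀ {n} (u v : Fin n) → (u == v) ≡ (v == u)
==-sym u v with u == v in eq
... | true  rewrite ==⇒≡ {u = u} {v} eq = sym (==-refl v)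
... | false = sym (≢⇒== λ v≡u → contradiction (trans (sym eq) (trans (cong (u ==_) v≡u) (==-refl u))) λ ())

∨-true : ∀ a b → a ∨ b ≡ true → a ≡ true ⊎ b ≡ true
∨-true true  b _ = inj₁ refl
∨-true false b p = inj₂ p

∧-false : ∀ a b → a ∧ b ≡ false → a ≡ false ⊎ b ≡ false
∧-false false b _ = inj₁ refl
∧-false true  b p = inj₂ p

-- Cardinalities through characteristic functions

lookup-⁅⁆ : ∀ {n} (x u : Fin n) → lookup ⁅ x ⁆ u ≡ (x == u)
lookup-⁅⁆ zero    zero    = refl
lookup-⁅⁆ zero    (suc u) = lookup-replicate u false
lookup-⁅⁆ (suc x) zero    = refl
lookup-⁅⁆ (suc x) (suc u) = lookup-⁅⁆ x u

∣∣≡size : ∀ {n} (p : Subset n) → ∣ p ∣ ≡ size (lookup p)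
∣∣≡size []          = refl
∣∣≡size (true ∷ p)  = cong suc (∣∣≡size p)
∣∣≡size (false ∷ p) = ∣∣≡size p

size-remove : ∀ {n} (L : Fin n → Bool) v → L v ≡ true → size L ≡ suc (size λ u → L u ∧ not (v == u))
size-remove L v v∈L = begin
  size L
    ≡⟨ sum-cong-≗ (λ u → split (L u) (v == u)) ⟩
  sum (λ u → 𝟙 (v == u) * 𝟙 (L u) + 𝟙 (L u ∧ not (v == u)))
    ≡⟨ ∑-distrib-+ (λ u → 𝟙 (v == u) * 𝟙 (L u)) _ ⟩
  sum (λ u → 𝟙 (v == u) * 𝟙 (L u)) + size (λ u → L u ∧ not (v == u))
    ≡⟨ cong (_+ size (λ u → L u ∧ not (v == u))) (trans (sum-pick v (𝟙 ∘ L)) (cong 𝟙 v∈L)) ⟩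
  suc (size λ u → L u ∧ not (v == u)) ∎
  where
  open ≡-Reasoning
  split : ∀ l e → 𝟙 l ≡ 𝟙 e * 𝟙 l + 𝟙 (l ∧ not e)
  split false false = refl
  split false true  = refl
  split true  false = refl
  split true  true  = refl

size≥2 : ∀ {n} (L : Fin n → Bool) a b → (a == b) ≡ false → L a ≡ true → L b ≡ true → 2 ≤ size L
size≥2 L a b a≠b a∈ b∈ = begin
  2                                          ≤⟨ s≤s (s≤s z≤n) ⟩
  suc (suc (size L″))                        ≡⟨ cong suc (size-remove L′ b (cong₂ _∧_ b∈ (cong not a≠b))) ⟨
  suc (size L′)                              ≡⟨ size-remove L a a∈ ⟨
  size L                                     ∎
  where
  open ≤-Reasoning
  L′ = λ u → L u ∧ not (a == u)
  L″ = λ u → L′ u ∧ not (b == u)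

size≥3 : ∀ {n} (L : Fin n → Bool) a b c → (a == b) ≡ false → (a == c) ≡ false → (b == c) ≡ false →
  L a ≡ true → L b ≡ true → L c ≡ true → 3 ≤ size L
size≥3 L a b c a≠b a≠c b≠c a∈ b∈ c∈ = ≤-trans
  (s≤s (size≥2 (λ u → L u ∧ not (a == u)) b c b≠c (cong₂ _∧_ b∈ (cong not a≠b)) (cong₂ _∧_ c∈ (cong not a≠c))))
  (≤-reflexive (sym (size-remove L a a∈)))

module Constraints {n : ℕ} (G : Graph n) where

  near : Fin n → Fin n → Bool
  near u v = adj G u v ∨ u == v

  near-refl : ∀ u → near u u ≡ true
  near-refl u = trans (cong (adj G u u ∨_) (==-refl u)) (Bool.∨-zeroʳ _)

  near-sym : ∀ {u v} → near u v ≡ true → near v u ≡ true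
  near-sym {u} {v} p = trans (cong₂ _∨_ (adj-sym G v u) (==-sym v u)) p

  adj⇒near : ∀ {u v} → adj G u v ≡ true → near u v ≡ true
  adj⇒near {u} {v} p = cong (_∨ u == v) p

  adj⇒≠ : ∀ {u v} → adj G u v ≡ true → (u == v) ≡ false
  adj⇒≠ {u} {v} p = ≢⇒== {u = u} {v} λ { refl → contradiction (trans (sym p) (irrefl G u)) λ () }

  -- A constraint (x, y, x′, y′, w) stands for the edges xy and x′y′, both near w;
  -- it is vacuous unless valid.  Pairs of edges with disjoint neighbourhoods need
  -- no constraint, and leaving them out keeps the number of constraints hit by a
  -- vertex bounded in terms of Δ.

  valid same : Vec (Fin n) 5 → Bool
  valid (x ∷ y ∷ x′ ∷ y′ ∷ w ∷ []) = (near w x ∧ near w x′) ∧ (adj G x y ∧ adj G x′ y′)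
  same  (x ∷ y ∷ x′ ∷ y′ ∷ w ∷ []) = (x′ == x ∨ x′ == y) ∧ (y′ == x ∨ y′ == y)

  dominators : Vec (Fin n) 5 → Fin n → Bool
  dominators (x ∷ y ∷ x′ ∷ y′ ∷ w ∷ []) u = (near x u ∨ near y u) ∨ (near x′ u ∨ near y′ u)

  -- Takes the values 0, 2 and 3; as a sum of indicators it translates directly into a term of the
  -- summation language.
  requirement : Vec (Fin n) 5 → ℕ
  requirement q = 𝟙 (valid q) + 𝟙 (valid q) + 𝟙 (valid q ∧ not (same q))

  open Multicover dominators requirement public

  record Valid (x y x′ y′ w : Fin n) : Set where
    constructor mkValid
    field
      wx  : near w x ≡ true
      wx′ : near w x′ ≡ true
      xy  : adj G x y ≡ true
      x′y′ : adj G x′ y′ ≡ true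

  valid⇒Valid : ∀ {x y x′ y′ w} → valid (x ∷ y ∷ x′ ∷ y′ ∷ w ∷ []) ≡ true → Valid x y x′ y′ w
  valid⇒Valid {x} {y} {x′} {y′} {w} p = mkValid
    (Bool.∧-conicalˡ _ _ l) (Bool.∧-conicalʳ (near w x) _ l)
    (Bool.∧-conicalˡ _ _ r) (Bool.∧-conicalʳ (adj G x y) _ r)
    where
    l = Bool.∧-conicalˡ _ _ p
    r = Bool.∧-conicalʳ (near w x ∧ near w x′) _ p

  Valid⇒valid : ∀ {x y x′ y′ w} → Valid x y x′ y′ w → valid (x ∷ y ∷ x′ ∷ y′ ∷ w ∷ []) ≡ true
  Valid⇒valid (mkValid a b c d) = cong₂ _∧_ (cong₂ _∧_ a b) (cong₂ _∧_ c d)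

  requirement-cases : ∀ q {m} → (valid q ≡ true → 2 ≤ m) → (valid q ≡ true → same q ≡ false → 3 ≤ m) → requirement q ≤ m
  requirement-cases q two three with valid q | same q
  ... | false | _     = z≤n
  ... | true  | true  = two refl
  ... | true  | false = three refl refl

  requirement≥2 : ∀ q → valid q ≡ true → 2 ≤ requirement q
  requirement≥2 q v rewrite v = s≤s (s≤s z≤n)

  requirement≥3 : ∀ q → valid q ≡ true → same q ≡ false → 3 ≤ requirement q
  requirement≥3 q v s rewrite v | s = ≤-refl

  -- Provides a reference solution in every graph, so that greedy progress is guaranteed. The third
  -- dominator is an end of the second edge that is not an end of the first.
  cover-all : Cover λ _ → true
  cover-all q@(x ∷ y ∷ x′ ∷ y′ ∷ w ∷ []) = requirement-cases q two three
    where
    L : Fin n → Bool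
    L u = dominators q u ∧ true
    x∈ : L x ≡ true
    x∈ rewrite near-refl x = refl
    y∈ : L y ≡ true
    y∈ rewrite near-refl y | Bool.∨-zeroʳ (near x y) = refl
    x′∈ : L x′ ≡ true
    x′∈ rewrite near-refl x′ | Bool.∨-zeroʳ (near x x′ ∨ near y x′) = refl
    y′∈ : L y′ ≡ true
    y′∈ rewrite near-refl y′ | Bool.∨-zeroʳ (near x′ y′) | Bool.∨-zeroʳ (near x y′ ∨ near y y′) = refl
    two : valid q ≡ true → 2 ≤ size L
    two v = size≥2 L x y (adj⇒≠ (Valid.xy (valid⇒Valid v))) x∈ y∈
    third : ∀ z → valid q ≡ true → L z ≡ true → (z == x ∨ z == y) ≡ false → 3 ≤ size L
    third z v z∈ z≠ = size≥3 L z x y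
      (Bool.∨-conicalˡ _ _ z≠) (Bool.∨-conicalʳ (z == x) _ z≠) (adj⇒≠ (Valid.xy (valid⇒Valid v))) z∈ x∈ y∈
    three : valid q ≡ true → same q ≡ false → 3 ≤ size L
    three v s with ∧-false (x′ == x ∨ x′ == y) _ s
    ... | inj₁ x′≠ = third x′ v x′∈ x′≠
    ... | inj₂ y′≠ = third y′ v y′∈ y′≠

  -- Liar's ve-dominating sets as covers

  -- Edges are stored in increasing order, while tuples list endpoints in either order.
  data Orients (e : Edge G) : Fin n → Fin n → Set where
    forward  : Orients e (Edge.x e) (Edge.y e)
    backward : Orients e (Edge.y e) (Edge.x e)

  orients-adj : ∀ {e a b} → Orients e a b → adj G a b ≡ true
  orients-adj {e} forward  = Edge.adjacent e
  orients-adj {e} backward = trans (adj-sym G _ _) (Edge.adjacent e)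

  orient : ∀ {a b} → adj G a b ≡ true → ∃ λ e → Orients e a b
  orient {a} {b} p with Fin.<-cmp a b
  ... | tri< a<b _ _ = edge a b a<b p , forward
  ... | tri≈ _ refl _ = contradiction (trans (sym p) (irrefl G a)) λ ()
  ... | tri> _ _ b<a = edge b a b<a (trans (adj-sym G b a) p) , backward

  dominates : Edge G → Fin n → Bool
  dominates e u = near (Edge.x e) u ∨ near (Edge.y e) u

  orients-dominates : ∀ {e a b} → Orients e a b → ∀ u → near a u ∨ near b u ≡ dominates e u
  orients-dominates     forward  u = refl
  orients-dominates {e} backward u = Bool.∨-comm (near (Edge.y e) u) _

  lookup-N[] : ∀ v u → lookup (N[_] G v) u ≡ near v u
  lookup-N[] v u = trans (lookup-zipWith _∨_ u (N G v) ⁅ v ⁆) (cong₂ _∨_ (lookup∘tabulate (adj G v) u) (lookup-⁅⁆ v u))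

  lookup-Nₑ[] : ∀ e u → lookup (Nₑ[_] G e) u ≡ dominates e u
  lookup-Nₑ[] e u = trans (lookup-zipWith _∨_ u (N[_] G (Edge.x e)) (N[_] G (Edge.y e)))
    (cong₂ _∨_ (lookup-N[] (Edge.x e) u) (lookup-N[] (Edge.y e) u))

  ∣Nₑ∩∣ : ∀ e L → ∣ Nₑ[_] G e ∩ L ∣ ≡ size λ u → dominates e u ∧ lookup L u
  ∣Nₑ∩∣ e L = trans (∣∣≡size (Nₑ[_] G e ∩ L)) (sum-cong-≗ λ u → cong 𝟙
    (trans (lookup-zipWith _∧_ u (Nₑ[_] G e) L) (cong (_∧ lookup L u) (lookup-Nₑ[] e u))))

  ∣Nₑ∪Nₑ∩∣ : ∀ e e′ L → ∣ (Nₑ[_] G e ∪ Nₑ[_] G e′) ∩ L ∣ ≡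
    size λ u → (dominates e u ∨ dominates e′ u) ∧ lookup L u
  ∣Nₑ∪Nₑ∩∣ e e′ L = trans (∣∣≡size ((Nₑ[_] G e ∪ Nₑ[_] G e′) ∩ L)) (sum-cong-≗ λ u → cong 𝟙
    (trans (lookup-zipWith _∧_ u (Nₑ[_] G e ∪ Nₑ[_] G e′) L) (cong (_∧ lookup L u)
      (trans (lookup-zipWith _∨_ u (Nₑ[_] G e) (Nₑ[_] G e′)) (cong₂ _∨_ (lookup-Nₑ[] e u) (lookup-Nₑ[] e′ u))))))

  cov-edges : ∀ {e e′ a b a′ b′} w → Orients e a b → Orients e′ a′ b′ → ∀ L →
    cov (lookup L) (a ∷ b ∷ a′ ∷ b′ ∷ w ∷ []) ≡ ∣ (Nₑ[_] G e ∪ Nₑ[_] G e′) ∩ L ∣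
  cov-edges {e} {e′} w o o′ L = trans
    (sum-cong-≗ λ u → cong (λ d → 𝟙 (d ∧ lookup L u)) (cong₂ _∨_ (orients-dominates o u) (orients-dominates o′ u)))
    (sym (∣Nₑ∪Nₑ∩∣ e e′ L))

  edge-≡ : ∀ {e e′ : Edge G} → Edge.x e ≡ Edge.x e′ → Edge.y e ≡ Edge.y e′ → e ≡ e′
  edge-≡ {edge x y x<y p} {edge _ _ x<y′ p′} refl refl
    rewrite Fin.<-irrelevant x<y x<y′ | Decidable⇒UIP.≡-irrelevant Bool._≟_ p p′ = refl

  endpoint : ∀ {e a b} → Orients e a b → ∀ {z} → (z == a ∨ z == b) ≡ true → z ≡ Edge.x e ⊎ z ≡ Edge.y e
  endpoint {a = a} {b} o {z} p with ∨-true (z == a) (z == b) p | o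
  ... | inj₁ za | forward  = inj₁ (==⇒≡ za)
  ... | inj₂ zb | forward  = inj₂ (==⇒≡ zb)
  ... | inj₁ za | backward = inj₂ (==⇒≡ za)
  ... | inj₂ zb | backward = inj₁ (==⇒≡ zb)

  -- Of the four coincidences, two would identify the ends of `e′`, and the crossed one would
  -- reverse the stored order.
  endpoints⇒≡ : ∀ {e e′ : Edge G} → Edge.x e′ ≡ Edge.x e ⊎ Edge.x e′ ≡ Edge.y e →
    Edge.y e′ ≡ Edge.x e ⊎ Edge.y e′ ≡ Edge.y e → e ≡ e′
  endpoints⇒≡ {e} {e′} (inj₁ p) (inj₂ q) = edge-≡ (sym p) (sym q)
  endpoints⇒≡ {e} {e′} (inj₁ p) (inj₁ q) = contradiction (trans p (sym q)) (Fin.<⇒≢ (Edge.x<y e′))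
  endpoints⇒≡ {e} {e′} (inj₂ p) (inj₂ q) = contradiction (trans p (sym q)) (Fin.<⇒≢ (Edge.x<y e′))
  endpoints⇒≡ {e} {e′} (inj₂ p) (inj₁ q) = contradiction (subst₂ Fin._<_ p q (Edge.x<y e′)) (Fin.<-asym (Edge.x<y e))

  same⇒≡ : ∀ {e e′ a b a′ b′} w → Orients e a b → Orients e′ a′ b′ →
    same (a ∷ b ∷ a′ ∷ b′ ∷ w ∷ []) ≡ true → e ≡ e′
  same⇒≡ {e} {e′} {a} {b} {a′} {b′} w o o′ s
    with endpoint o {a′} (Bool.∧-conicalˡ _ _ s) | endpoint o {b′} (Bool.∧-conicalʳ (a′ == a ∨ a′ == b) _ s) | o′
  ... | p | q | forward  = endpoints⇒≡ {e} {e′} p q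
  ... | p | q | backward = endpoints⇒≡ {e} {e′} q p

  same-refl : ∀ {e a b a′ b′} w → Orients e a b → Orients e a′ b′ → same (a ∷ b ∷ a′ ∷ b′ ∷ w ∷ []) ≡ true
  same-refl {a = a} {b} w forward  forward  rewrite ==-refl a | ==-refl b | Bool.∨-zeroʳ (b == a) = refl
  same-refl {a = a} {b} w forward  backward rewrite ==-refl a | ==-refl b | Bool.∨-zeroʳ (b == a) = refl
  same-refl {a = a} {b} w backward forward  rewrite ==-refl a | ==-refl b | Bool.∨-zeroʳ (b == a) = refl
  same-refl {a = a} {b} w backward backward rewrite ==-refl a | ==-refl b | Bool.∨-zeroʳ (b == a) = refl

  liars⇒cover : ∀ {L} → LiarsVEDominating G L → Cover (lookup L)
  liars⇒cover {L} liars q@(x ∷ y ∷ x′ ∷ y′ ∷ w ∷ []) = requirement-cases q two three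
    where
    open LiarsVEDominating liars
    two : valid q ≡ true → 2 ≤ cov (lookup L) q
    two v with e , o ← orient (Valid.xy (valid⇒Valid v)) = begin
      2                                                ≤⟨ single e ⟩
      ∣ Nₑ[_] G e ∩ L ∣                                ≡⟨ ∣Nₑ∩∣ e L ⟩
      size (λ u → dominates e u ∧ lookup L u)          ≤⟨ sum-mono (λ u → weaken (lookup L u) (near x′ u ∨ near y′ u) (orients-dominates o u)) ⟩
      cov (lookup L) q                                 ∎
      where
      open ≤-Reasoning
      weaken : ∀ l c {a b} → a ≡ b → 𝟙 (b ∧ l) ≤ 𝟙 ((a ∨ c) ∧ l)
      weaken l c {false} refl = z≤n
      weaken l c {true}  refl = ≤-refl
    three : valid q ≡ true → same q ≡ false → 3 ≤ cov (lookup L) q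
    three v s with e , o ← orient (Valid.xy (valid⇒Valid v)) | e′ , o′ ← orient (Valid.x′y′ (valid⇒Valid v)) =
      ≤-trans (pair e e′ λ { refl → contradiction (trans (sym s) (same-refl w o o′)) λ () })
              (≤-reflexive (sym (cov-edges w o o′ L)))

  -- `valid` asks only the first endpoint of each edge to be near `w`, so the orientation is chosen
  -- accordingly.
  towards : ∀ {e w} → dominates e w ≡ true → ∃₂ λ a b → Orients e a b × near w a ≡ true
  towards {e} {w} d with ∨-true (near (Edge.x e) w) _ d
  ... | inj₁ xw = _ , _ , forward , near-sym xw
  ... | inj₂ yw = _ , _ , backward , near-sym yw

  cover⇒liars : ∀ {L} → Cover (lookup L) → LiarsVEDominating G L
  cover⇒liars {L} cover = record { single = single ; pair = pair }
    where
    single : ∀ e → 2 ≤ ∣ Nₑ[_] G e ∩ L ∣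
    single e@(edge x y _ xy) = begin
      2                                                  ≤⟨ requirement≥2 q (Valid⇒valid (mkValid (near-refl x) (near-refl x) xy xy)) ⟩
      requirement q                                      ≤⟨ cover q ⟩
      cov (lookup L) q                                   ≡⟨ sum-cong-≗ (λ u → cong (λ d → 𝟙 (d ∧ lookup L u)) (Bool.∨-idem (dominates e u))) ⟩
      size (λ u → dominates e u ∧ lookup L u)            ≡⟨ ∣Nₑ∩∣ e L ⟨
      ∣ Nₑ[_] G e ∩ L ∣                                  ∎
      where
      open ≤-Reasoning
      -- A single edge is the pair of that edge with itself, centred at its own end `x`.
      q = x ∷ y ∷ x ∷ y ∷ x ∷ []
    pair : ∀ e e′ → e ≢ e′ → 3 ≤ ∣ (Nₑ[_] G e ∪ Nₑ[_] G e′) ∩ L ∣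
    pair e e′ e≢e′ with any? (λ w → dominates e w ∧ dominates e′ w Bool.≟ true)
    ... | yes (w , d)
      with a , b , o , wa ← towards {e} {w} (Bool.∧-conicalˡ _ _ d)
         | a′ , b′ , o′ , wa′ ← towards {e′} {w} (Bool.∧-conicalʳ (dominates e w) _ d) = begin
      3                                                  ≤⟨ requirement≥3 q (Valid⇒valid (mkValid wa wa′ (orients-adj o) (orients-adj o′)))
                                                              (Bool.¬-not (e≢e′ ∘ same⇒≡ w o o′)) ⟩
      requirement q                                      ≤⟨ cover q ⟩
      cov (lookup L) q                                   ≡⟨ cov-edges w o o′ L ⟩
      ∣ (Nₑ[_] G e ∪ Nₑ[_] G e′) ∩ L ∣                   ∎
      where
      open ≤-Reasoning
      q = a ∷ b ∷ a′ ∷ b′ ∷ w ∷ []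
    ... | no disjoint = begin
      3                                                  ≤⟨ n≤1+n 3 ⟩
      2 + 2                                              ≤⟨ +-mono-≤ (single e) (single e′) ⟩
      ∣ Nₑ[_] G e ∩ L ∣ + ∣ Nₑ[_] G e′ ∩ L ∣             ≡⟨ cong₂ _+_ (∣Nₑ∩∣ e L) (∣Nₑ∩∣ e′ L) ⟩
      size (λ u → dominates e u ∧ lookup L u) + size (λ u → dominates e′ u ∧ lookup L u)
                                                         ≡⟨ ∑-distrib-+ (λ u → 𝟙 (dominates e u ∧ lookup L u)) _ ⟨
      sum (λ u → 𝟙 (dominates e u ∧ lookup L u) + 𝟙 (dominates e′ u ∧ lookup L u))
                                                         ≤⟨ sum-mono (λ u → add (dominates e u) (dominates e′ u) (lookup L u) λ d → disjoint (u , d)) ⟩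
      size (λ u → (dominates e u ∨ dominates e′ u) ∧ lookup L u)
                                                         ≡⟨ ∣Nₑ∪Nₑ∩∣ e e′ L ⟨
      ∣ (Nₑ[_] G e ∪ Nₑ[_] G e′) ∩ L ∣                   ∎
      where
      open ≤-Reasoning
      add : ∀ a b l → a ∧ b ≢ true → 𝟙 (a ∧ l) + 𝟙 (b ∧ l) ≤ 𝟙 ((a ∨ b) ∧ l)
      add false b     l _   = ≤-refl
      add true  false l _   = ≤-reflexive (+-identityʳ _)
      add true  true  l ¬ab = contradiction refl ¬ab

  -- Walks and the number of constraints hit by a vertex

  -- Counts walks of length `k` in the graph with a loop added at every vertex; the loops let
  -- shorter walks be padded.
  walks : ℕ → Fin n → Fin n → ℕ
  walks zero    v u = 𝟙 (v == u)
  walks (suc k) v u = sum λ z → walks k v z * 𝟙 (near z u)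

  degree≤Δ : ∀ v → degree G v ≤ Δ G
  degree≤Δ v = All.lookup (xs≤max 0 (List.map (degree G) (allFin n))) (∈-map⁺ (degree G) (∈-allFin v))

  size-near : ∀ z → size (near z) ≤ suc (Δ G)
  size-near z = begin
    size (near z)                                    ≤⟨ sum-mono (λ u → bound (adj G z u) (z == u)) ⟩
    sum (λ u → 𝟙 (z == u) * 1 + 𝟙 (adj G z u))       ≡⟨ ∑-distrib-+ (λ u → 𝟙 (z == u) * 1) _ ⟩
    sum (λ u → 𝟙 (z == u) * 1) + size (adj G z)      ≡⟨ cong₂ _+_ (sum-pick z (λ _ → 1)) (sym deg) ⟩
    suc (degree G z)                                 ≤⟨ s≤s (degree≤Δ z) ⟩
    suc (Δ G)                                        ∎
    where
    open ≤-Reasoning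
    bound : ∀ a e → 𝟙 (a ∨ e) ≤ 𝟙 e * 1 + 𝟙 a
    bound false false = ≤-refl
    bound false true  = ≤-refl
    bound true  e     = m≤n+m 1 _
    deg : degree G z ≡ size (adj G z)
    deg = trans (∣∣≡size (N G z)) (sum-cong-≗ λ u → cong 𝟙 (lookup∘tabulate (adj G z) u))

  walks-total : ∀ k v → sum (walks k v) ≤ suc (Δ G) ^ k
  walks-total zero    v = ≤-reflexive (trans (sum-cong-≗ λ u → sym (*-identityʳ (𝟙 (v == u)))) (sum-pick v (λ _ → 1)))
  walks-total (suc k) v = begin
    sum (λ u → sum λ z → walks k v z * 𝟙 (near z u))  ≡⟨ ∑-comm (λ u z → walks k v z * 𝟙 (near z u)) ⟩
    sum (λ z → sum λ u → walks k v z * 𝟙 (near z u))  ≡⟨ sum-cong-≗ (λ z → *-distribˡ-sum (walks k v z) (𝟙 ∘ near z)) ⟨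
    sum (λ z → walks k v z * size (near z))           ≤⟨ sum-mono (λ z → *-monoʳ-≤ (walks k v z) (size-near z)) ⟩
    sum (λ z → walks k v z * suc (Δ G))               ≡⟨ *-distribʳ-sum (suc (Δ G)) (walks k v) ⟨
    sum (walks k v) * suc (Δ G)                       ≤⟨ *-monoˡ-≤ (suc (Δ G)) (walks-total k v) ⟩
    suc (Δ G) ^ k * suc (Δ G)                         ≡⟨ *-comm (suc (Δ G) ^ k) _ ⟩
    suc (Δ G) ^ suc k                                 ∎
    where open ≤-Reasoning

  Reach : ℕ → Fin n → Fin n → Set
  Reach k v u = 1 ≤ walks k v u

  start : ∀ v → Reach 0 v v
  start v = ≤-reflexive (cong 𝟙 (sym (==-refl v)))

  step : ∀ {k v z u} → Reach k v z → near z u ≡ true → Reach (suc k) v u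
  step {k} {v} {z} {u} r zu = begin
    1                          ≤⟨ r ⟩
    walks k v z                ≡⟨ *-identityʳ _ ⟨
    walks k v z * 1            ≡⟨ cong (λ b → walks k v z * 𝟙 b) zu ⟨
    walks k v z * 𝟙 (near z u) ≤⟨ term≤sum (λ z → walks k v z * 𝟙 (near z u)) z ⟩
    walks (suc k) v u          ∎
    where open ≤-Reasoning

  stay : ∀ {k v u} → Reach k v u → Reach (suc k) v u
  stay {k} {v} {u} r = step {k} {v} {u} {u} r (near-refl u)

  -- The walk is v, x, w or v, y, x, w.
  hub : ∀ {x y w v} → adj G x y ≡ true → near w x ≡ true → near x v ∨ near y v ≡ true → Reach 3 v w
  hub {x} {y} {w} {v} xy wx d with ∨-true (near x v) _ d
  ... | inj₁ xv = stay {2} {v} {w} (step {1} {v} {x} {w} (step {0} {v} {v} {x} (start v) (near-sym xv)) (near-sym wx))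
  ... | inj₂ yv = step {2} {v} {x} {w}
    (step {1} {v} {y} {x} (step {0} {v} {v} {y} (start v) (near-sym yv)) (near-sym (adj⇒near xy))) (near-sym wx)

  -- From `v`, the centre `w` is within 3 steps, `x` and `x′` within 4, and `y` and `y′` within 5. A
  -- hit tuple thus has weight at least 1 under the counts of 5-step walks, and the total weight is
  -- a fifth power.
  hits≤ : ∀ v → hits v ≤ (suc (Δ G) ^ 5) ^ 5
  hits≤ v = begin
    hits v                         ≤⟨ sums-mono 5 pointwise ⟩
    sums 5 (weight (walks 5 v))    ≡⟨ sums-weight 5 (walks 5 v) ⟩
    sum (walks 5 v) ^ 5            ≤⟨ ^-monoˡ-≤ 5 (walks-total 5 v) ⟩
    (suc (Δ G) ^ 5) ^ 5            ∎
    where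
    open ≤-Reasoning
    weight≥1 : ∀ {x y x′ y′ w} → Valid x y x′ y′ w → dominators (x ∷ y ∷ x′ ∷ y′ ∷ w ∷ []) v ≡ true →
      1 ≤ weight (walks 5 v) (x ∷ y ∷ x′ ∷ y′ ∷ w ∷ [])
    weight≥1 {x} {y} {x′} {y′} {w} (mkValid wx wx′ xy x′y′) d =
      *-mono-≤ {1} {walks 5 v x} (stay {4} {v} {x} vx) (*-mono-≤ (step {4} {v} {x} {y} vx (adj⇒near xy))
        (*-mono-≤ (stay {4} {v} {x′} vx′) (*-mono-≤ (step {4} {v} {x′} {y′} vx′ (adj⇒near x′y′))
          (*-mono-≤ {1} {walks 5 v w} {1} {1} (stay {4} {v} {w} (stay {3} {v} {w} vw)) ≤-refl))))
      where
      vw : Reach 3 v w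
      vw with ∨-true (near x v ∨ near y v) _ d
      ... | inj₁ d₁ = hub xy wx d₁
      ... | inj₂ d₂ = hub x′y′ wx′ d₂
      vx : Reach 4 v x
      vx = step {3} {v} {w} {x} vw wx
      vx′ : Reach 4 v x′
      vx′ = step {3} {v} {w} {x′} vw wx′
    pointwise : ∀ q → 𝟙 (dominators q v) ⊓ requirement q ≤ weight (walks 5 v) q
    pointwise q@(x ∷ y ∷ x′ ∷ y′ ∷ w ∷ []) with dominators q v in d | valid q in val
    ... | false | _     = z≤n
    ... | true  | false = z≤n
    ... | true  | true  = weight≥1 (valid⇒Valid {x} {y} {x′} {y′} {w} val) d

-- The greedy choice as a bounded sum

-- An index v contributes 0 if some w ≤ v has c w ≡ 0, and 1 otherwise.

firstZero : ∀ {n} → (Fin n → ℕ) → ℕ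
firstZero {n} c = sum λ (v : Fin n) → 1 ∸ sum λ (w : Fin n) → 1 ∸ ((toℕ w ∸ toℕ v) + c w)

firstZero-spec : ∀ {n} (c : Fin n → ℕ) i → c i ≡ 0 → ∃ λ j → firstZero c ≡ toℕ j × c j ≡ 0
firstZero-spec {suc n} c i ci≡0 with c zero in c₀
... | zero = zero
  , sum-zero {suc n} (λ v → found (toℕ v))
  , c₀
  where
  found : ∀ v → 1 ∸ (1 ∸ ((0 ∸ v) + 0) + sum (λ w → 1 ∸ ((suc (toℕ w) ∸ v) + c (suc w)))) ≡ 0
  found v rewrite 0∸n≡0 v = 0∸n≡0 (sum λ w → 1 ∸ ((suc (toℕ w) ∸ v) + c (suc w)))
... | suc x with i
...   | zero  = contradiction (trans (sym c₀) ci≡0) λ ()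
...   | suc i =
  let j , eq , cj≡0 = firstZero-spec (c ∘ suc) i ci≡0 in
  -- Index 0 is no zero of `c`: it contributes 1, shifting the recursive answer by one, and adds
  -- nothing to the inner sums of later indices.
  suc j , cong₂ _+_ (cong (1 ∸_) first) (trans (sum-cong-≗ {n} λ v → skip′ (toℕ v)) eq) , cj≡0
  where
  first : 0 ∸ x + sum (λ w → 0 ∸ (toℕ w + c (suc w))) ≡ 0
  first = cong₂ _+_ (0∸n≡0 x) (sum-zero {n} λ w → 0∸n≡0 (toℕ w + c (suc w)))
  skip′ : ∀ v → 1 ∸ (1 ∸ ((0 ∸ suc v) + suc x) + sum (λ w → 1 ∸ ((toℕ w ∸ v) + c (suc w)))) ≡
    1 ∸ sum (λ w → 1 ∸ ((toℕ w ∸ v) + c (suc w)))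
  skip′ v = cong (λ z → 1 ∸ (z + sum (λ w → 1 ∸ ((toℕ w ∸ v) + c (suc w))))) (0∸n≡0 x)

minimiser : ∀ {n} (f : Fin (suc n) → ℕ) → ∃ λ b → ∀ u → f b ≤ f u
minimiser {zero}  f = zero , λ { zero → ≤-refl }
minimiser {suc n} f with minimiser (f ∘ suc)
... | b , b-min with f zero ≤? f (suc b)
...   | yes p = zero , λ { zero → ≤-refl ; (suc u) → ≤-trans p (b-min u) }
...   | no  p = suc b , λ { zero → <⇒≤ (≰⇒> p) ; (suc u) → b-min u }

-- Vanishes exactly at the minimisers of `f`, turning the search for a minimum into one for a zero.
excess : ∀ {n} → (Fin n → ℕ) → Fin n → ℕ
excess f w = sum λ u → f w ∸ f u

-- The argument in `Fin n` excludes n = 0, where there is no minimiser.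
argmin-spec : ∀ {n} (f : Fin n → ℕ) → Fin n → ∃ λ b → firstZero (excess f) ≡ toℕ b × (∀ u → f b ≤ f u)
argmin-spec {suc n} f _ =
  let b , b-min = minimiser f
      j , eq , zero-j = firstZero-spec (excess f) b
        (sum-zero {suc n} λ u → m≤n⇒m∸n≡0 (b-min u))
  in j , eq , λ u → m∸n≡0⇒m≤n (n≤0⇒n≡0 (≤-trans (term≤sum (λ u → f j ∸ f u) u) (≤-reflexive zero-j)))

-- Boolean connectives by truncated subtraction

∸≡ᵇ : ∀ m n → 1 ∸ ((m ∸ n) + (n ∸ m)) ≡ 𝟙 (m ≡ᵇ n)
∸≡ᵇ zero    zero    = refl
∸≡ᵇ zero    (suc n) = 0∸n≡0 n
∸≡ᵇ (suc m) zero    = 0∸n≡0 (m + 0)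
∸≡ᵇ (suc m) (suc n) = ∸≡ᵇ m n

∸-pos : ∀ m → 1 ∸ (1 ∸ m) ≡ 𝟙 (0 <ᵇ m)
∸-pos zero    = refl
∸-pos (suc m) = cong (1 ∸_) (0∸n≡0 m)

∸-and : ∀ a b → 1 ∸ ((1 ∸ 𝟙 a) + (1 ∸ 𝟙 b)) ≡ 𝟙 (a ∧ b)
∸-and false b     = 0∸n≡0 (1 ∸ 𝟙 b)
∸-and true  false = refl
∸-and true  true  = refl

∸-or : ∀ a b → 1 ∸ (1 ∸ (𝟙 a + 𝟙 b)) ≡ 𝟙 (a ∨ b)
∸-or false false = refl
∸-or false true  = refl
∸-or true  b     = cong (1 ∸_) (0∸n≡0 (𝟙 b))

∸-not : ∀ a → 1 ∸ 𝟙 a ≡ 𝟙 (not a)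
∸-not false = refl
∸-not true  = refl

module _ {k : ℕ} where

  notᵗ posᵗ : Term k → Term k
  notᵗ t = num 1 ⊟ t
  posᵗ t = num 1 ⊟ (num 1 ⊟ t)

  andᵗ orᵗ : Term k → Term k → Term k
  andᵗ s t = num 1 ⊟ ((num 1 ⊟ s) ⊞ (num 1 ⊟ t))
  orᵗ  s t = num 1 ⊟ (num 1 ⊟ (s ⊞ t))

  eqᵗ adjᵗ nearᵗ : Fin k → Fin k → Term k
  eqᵗ i j   = num 1 ⊟ ((var i ⊟ var j) ⊞ (var j ⊟ var i))
  -- There is no multiplication: n * i is the sum of n copies of i.
  adjᵗ i j  = cell 1F (∑ (var (suc i)) ⊞ var j)
  nearᵗ i j = orᵗ (adjᵗ i j) (eqᵗ i j)

∑* : ∀ k {m} → Term (k + m) → Term m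
∑* zero    t = t
∑* (suc k) t = ∑* k (∑ t)

validᵗ sameᵗ requirementᵗ : ∀ {k} → Term (5 + k)
validᵗ = andᵗ (andᵗ (nearᵗ 4F 0F) (nearᵗ 4F 2F)) (andᵗ (adjᵗ 0F 1F) (adjᵗ 2F 3F))
sameᵗ  = andᵗ (orᵗ (eqᵗ 2F 0F) (eqᵗ 2F 1F)) (orᵗ (eqᵗ 3F 0F) (eqᵗ 3F 1F))
requirementᵗ = validᵗ ⊞ validᵗ ⊞ andᵗ validᵗ (notᵗ sameᵗ)

dominatorsᵗ : ∀ {k} → Term (6 + k)
dominatorsᵗ = orᵗ (orᵗ (nearᵗ 1F 0F) (nearᵗ 2F 0F)) (orᵗ (nearᵗ 3F 0F) (nearᵗ 4F 0F))

-- The argument decides membership of variable 0 in the set under consideration;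
-- variables 1 to 5 are the constraint.

potentialᵗ : ∀ {k} → Term (6 + k) → Term k
potentialᵗ member = ∑* 5 (requirementᵗ ⊟ ∑ (andᵗ dominatorsᵗ member))

chosenᵗ : ∀ {k} → Term (6 + k)
chosenᵗ = posᵗ (cell 2F (var 0F))

-- The shift by 6 passes over the tested vertex and the five coordinates of the constraint.
insertᵗ : ∀ {k} → Fin k → Term (6 + k)
insertᵗ i = orᵗ (eqᵗ (6 ↑ʳ i) 0F) chosenᵗ

-- Under the outer sum, variable 1 is the candidate and variable 0 its competitor.
excessᵗ : Term 2
excessᵗ = ∑ (potentialᵗ (insertᵗ 1F) ⊟ potentialᵗ (insertᵗ 0F))

-- The first vertex with minimal potential after insertion; see firstZero.

choiceᵗ : Term 0
choiceᵗ = ∑ (num 1 ⊟ ∑ (num 1 ⊟ ((var 0F ⊟ var 1F) ⊞ excessᵗ)))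

-- Meaning of the terms

module Semantics {n : ℕ} (G : Graph n) (ℓ : ℕ → ℕ) where

  open Constraints G

  memory : Store
  memory 0 = input G 0
  memory 1 = adjacencyMatrix G
  memory 2 = ℓ
  memory (suc (suc (suc _))) _ = 0

  chosen : Fin n → Bool
  chosen u = 0 <ᵇ ℓ (toℕ u)

  adjacencyMatrix-lookup : ∀ u v → adjacencyMatrix G (n * toℕ u + toℕ v) ≡ 𝟙 (adj G u v)
  adjacencyMatrix-lookup u v with n * toℕ u + toℕ v <? n * n
  ... | no  i≮ = contradiction (subst (_< n * n) (toℕ-combine u v) (toℕ<n (combine u v))) i≮
  ... | yes i< = trans
    (cong (λ p → if uncurry (adj G) p then 1 else 0) (trans (cong (remQuot {n} n) i≡) (remQuot-combine u v)))
    (if-𝟙 (adj G u v))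
    where
    i≡ : fromℕ< i< ≡ combine u v
    i≡ = toℕ-injective (trans (toℕ-fromℕ< i<) (sym (toℕ-combine u v)))
    if-𝟙 : ∀ b → (if b then 1 else 0) ≡ 𝟙 b
    if-𝟙 false = refl
    if-𝟙 true  = refl

  -- A record keeps the term and the Boolean visible to unification, which a bare equation of values
  -- would not.
  record Decides {k} (ρ : Vec ℕ k) (t : Term k) (b : Bool) : Set where
    constructor decides
    field value : ⟦ t ⟧ memory ρ ≡ 𝟙 b
  open Decides

  module _ {k} {ρ : Vec ℕ k} where

    and-sem : ∀ {s t a b} → Decides ρ s a → Decides ρ t b → Decides ρ (andᵗ s t) (a ∧ b)
    and-sem {a = a} {b} p q = decides (trans (cong₂ (λ x y → 1 ∸ ((1 ∸ x) + (1 ∸ y))) (value p) (value q)) (∸-and a b))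

    or-sem : ∀ {s t a b} → Decides ρ s a → Decides ρ t b → Decides ρ (orᵗ s t) (a ∨ b)
    or-sem {a = a} {b} p q = decides (trans (cong₂ (λ x y → 1 ∸ (1 ∸ (x + y))) (value p) (value q)) (∸-or a b))

    not-sem : ∀ {t a} → Decides ρ t a → Decides ρ (notᵗ t) (not a)
    not-sem {a = a} p = decides (trans (cong (1 ∸_) (value p)) (∸-not a))

    eq-sem : ∀ i j {m n} → lookup ρ i ≡ m → lookup ρ j ≡ n → Decides ρ (eqᵗ i j) (m ≡ᵇ n)
    eq-sem i j refl refl = decides (∸≡ᵇ (lookup ρ i) (lookup ρ j))

    adj-sem : ∀ i j {u v} → lookup ρ i ≡ toℕ u → lookup ρ j ≡ toℕ v → Decides ρ (adjᵗ i j) (adj G u v)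
    adj-sem i j {u} {v} p q = decides (trans
      (cong (adjacencyMatrix G) (cong₂ _+_ (trans (sum-const n (lookup ρ i)) (cong (n *_) p)) q))
      (adjacencyMatrix-lookup u v))

    near-sem : ∀ i j {u v} → lookup ρ i ≡ toℕ u → lookup ρ j ≡ toℕ v → Decides ρ (nearᵗ i j) (near u v)
    near-sem i j p q = or-sem (adj-sem i j p q) (eq-sem i j p q)

  ∑*-sem : ∀ j {k} {ρ : Vec ℕ k} (t : Term (j + k)) →
    ⟦ ∑* j t ⟧ memory ρ ≡ sums j λ (q : Vec (Fin n) j) → ⟦ t ⟧ memory (map toℕ q ++ ρ)
  ∑*-sem zero    t = refl
  ∑*-sem (suc j) t = ∑*-sem j (∑ t)

  module _ {k} {ρ : Vec ℕ k} where

    requirement-sem : ∀ q → ⟦ requirementᵗ ⟧ memory (map toℕ q ++ ρ) ≡ requirement q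
    requirement-sem q@(x ∷ y ∷ x′ ∷ y′ ∷ w ∷ []) =
      cong₂ _+_ (cong₂ _+_ (value valid-sem) (value valid-sem)) (value (and-sem valid-sem (not-sem same-sem)))
      where
      valid-sem : Decides (map toℕ q ++ ρ) validᵗ (valid q)
      valid-sem = and-sem
        (and-sem (near-sem 4F 0F {w} {x} refl refl) (near-sem 4F 2F {w} {x′} refl refl))
        (and-sem (adj-sem 0F 1F {x} {y} refl refl) (adj-sem 2F 3F {x′} {y′} refl refl))
      same-sem : Decides (map toℕ q ++ ρ) sameᵗ (same q)
      same-sem = and-sem (or-sem (eq-sem 2F 0F refl refl) (eq-sem 2F 1F refl refl))
                         (or-sem (eq-sem 3F 0F refl refl) (eq-sem 3F 1F refl refl))

    dominators-sem : ∀ q u → Decides (toℕ u ∷ map toℕ q ++ ρ) dominatorsᵗ (dominators q u)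
    dominators-sem (x ∷ y ∷ x′ ∷ y′ ∷ w ∷ []) u = or-sem
      (or-sem (near-sem 1F 0F refl refl) (near-sem 2F 0F refl refl))
      (or-sem (near-sem 3F 0F refl refl) (near-sem 4F 0F refl refl))

    potential-sem : ∀ {member L} → (∀ q u → Decides (toℕ u ∷ map toℕ q ++ ρ) member (L u)) →
      ⟦ potentialᵗ member ⟧ memory ρ ≡ potential L
    potential-sem {member} member-sem = trans (∑*-sem 5 (requirementᵗ ⊟ ∑ (andᵗ dominatorsᵗ member)))
      (sums-cong 5 λ q → cong₂ _∸_ (requirement-sem q)
        (sum-cong-≗ λ u → value (and-sem (dominators-sem q u) (member-sem q u))))

    chosen-sem : ∀ (q : Vec (Fin n) 5) u → Decides (toℕ u ∷ map toℕ q ++ ρ) chosenᵗ (chosen u)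
    chosen-sem q u = decides (∸-pos (ℓ (toℕ u)))

    insert-sem : ∀ i (q : Vec (Fin n) 5) u → Decides (toℕ u ∷ map toℕ q ++ ρ) (insertᵗ i) (insert (lookup ρ i) chosen u)
    insert-sem i q@(_ ∷ _ ∷ _ ∷ _ ∷ _ ∷ []) u = or-sem (eq-sem (6 ↑ʳ i) 0F refl refl) (chosen-sem q u)

  choice gap : ℕ
  choice = ⟦ choiceᵗ ⟧ memory []
  gap    = ⟦ potentialᵗ chosenᵗ ⟧ memory []

  gap-sem : gap ≡ potential chosen
  gap-sem = potential-sem {ρ = []} {chosenᵗ} chosen-sem

  Ψ : Fin n → ℕ
  Ψ v = potential (insert (toℕ v) chosen)

  inserted-sem : ∀ {k} (ρ : Vec ℕ k) i →
    ⟦ potentialᵗ (insertᵗ i) ⟧ memory ρ ≡ potential (insert (lookup ρ i) chosen)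
  inserted-sem ρ i = potential-sem {ρ = ρ} {insertᵗ i} (insert-sem i)

  excess-sem : ∀ v w → ⟦ excessᵗ ⟧ memory (toℕ w ∷ v ∷ []) ≡ excess Ψ w
  excess-sem v w = sum-cong-≗ {n} {y = λ u → Ψ w ∸ Ψ u} λ u → cong₂ _∸_
    (inserted-sem (toℕ u ∷ toℕ w ∷ v ∷ []) 1F) (inserted-sem (toℕ u ∷ toℕ w ∷ v ∷ []) 0F)

  choice-sem : choice ≡ firstZero (excess Ψ)
  choice-sem = sum-cong-≗ {n} λ v → cong (1 ∸_) (after v)
    where
    after : ∀ (v : Fin n) → sum {n} (λ w → 1 ∸ ((toℕ w ∸ toℕ v) + ⟦ excessᵗ ⟧ memory (toℕ w ∷ toℕ v ∷ [])))
      ≡ sum {n} (λ w → 1 ∸ ((toℕ w ∸ toℕ v) + excess Ψ w))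
    after v = sum-cong-≗ {n} λ w → cong (λ x → 1 ∸ ((toℕ w ∸ toℕ v) + x)) (excess-sem (toℕ v) w)

  -- Adding the gap to the cell, rather than storing 1, makes a round idle when the potential is 0
  -- without any test in the program.
  mark : ℕ → ℕ → ℕ → ℕ
  mark v a i = if v ≡ᵇ i then ℓ v + a else ℓ i

  next : ℕ → ℕ
  next = mark choice gap

-- Growth rates

PolyBounded : (ℕ → ℕ) → Set
PolyBounded f = ∃ λ c → ∃ λ k → ∀ n → f n ≤ c * suc n ^ k

poly-≤ : ∀ {f g} → (∀ n → f n ≤ g n) → PolyBounded g → PolyBounded f
poly-≤ f≤g (c , k , g≤) = c , k , λ n → ≤-trans (f≤g n) (g≤ n)

poly-const : ∀ c → PolyBounded λ _ → c
poly-const c = c , 0 , λ n → ≤-reflexive (sym (*-identityʳ c))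

poly-id : PolyBounded λ n → n
poly-id = 1 , 1 , λ n → ≤-trans (n≤1+n n) (≤-reflexive (sym (trans (*-identityˡ (suc n * 1)) (*-identityʳ (suc n)))))

poly-+ : ∀ {f g} → PolyBounded f → PolyBounded g → PolyBounded λ n → f n + g n
poly-+ {f} {g} (c , k , f≤) (d , l , g≤) = c + d , k + l , λ n → begin
  f n + g n                                    ≤⟨ +-mono-≤ (f≤ n) (g≤ n) ⟩
  c * suc n ^ k + d * suc n ^ l                ≤⟨ +-mono-≤ (*-monoʳ-≤ c (^-monoʳ-≤ (suc n) (m≤m+n k l)))
                                                           (*-monoʳ-≤ d (^-monoʳ-≤ (suc n) (m≤n+m l k))) ⟩
  c * suc n ^ (k + l) + d * suc n ^ (k + l)    ≡⟨ *-distribʳ-+ (suc n ^ (k + l)) c d ⟨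
  (c + d) * suc n ^ (k + l)                    ∎
  where open ≤-Reasoning

poly-* : ∀ {f g} → PolyBounded f → PolyBounded g → PolyBounded λ n → f n * g n
poly-* {f} {g} (c , k , f≤) (d , l , g≤) = c * d , k + l , λ n → begin
  f n * g n                          ≤⟨ *-mono-≤ (f≤ n) (g≤ n) ⟩
  c * suc n ^ k * (d * suc n ^ l)    ≡⟨ [m*n]*[o*p]≡[m*o]*[n*p] c (suc n ^ k) d (suc n ^ l) ⟩
  c * d * (suc n ^ k * suc n ^ l)    ≡⟨ cong (c * d *_) (^-distribˡ-+-* (suc n) k l) ⟨
  c * d * suc n ^ (k + l)            ∎
  where open ≤-Reasoning

poly-^ : ∀ {f} k → PolyBounded f → PolyBounded λ n → f n ^ k
poly-^ zero    p = poly-const 1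
poly-^ (suc k) p = poly-* p (poly-^ k p)

poly-loopTime : ∀ {s f} → PolyBounded s → PolyBounded f → PolyBounded λ n → loopTime (s n) (f n)
poly-loopTime {s} {f} ps pf = poly-≤ (λ n → ≤-reflexive (loopTime-closed (s n) (f n)))
  (poly-+ (poly-const 3) (poly-* pf (poly-+ (poly-const 3) ps)))

loopTime-mono : ∀ s {k l} → k ≤ l → loopTime s k ≤ loopTime s l
loopTime-mono s {k} {l} k≤l rewrite loopTime-closed s k | loopTime-closed s l = +-monoʳ-≤ 3 (*-monoˡ-≤ (3 + s) k≤l)

poly-time : ∀ {k} (t : Term k) → PolyBounded (time t)
poly-time (var i)    = poly-const 4
poly-time (num c)    = poly-const 3
poly-time (cell b t) = poly-+ (poly-time t) (poly-const 5)
poly-time (s ⊞ t)    = poly-+ (poly-time s) (poly-+ (poly-time t) (poly-const 7))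
poly-time (s ⊟ t)    = poly-+ (poly-time s) (poly-+ (poly-time t) (poly-const 7))
poly-time (∑ t)      = poly-+ (poly-const 3) (poly-+ (poly-const 4)
  (poly-loopTime (poly-+ (poly-const 6) (poly-+ (poly-time t) (poly-const 7))) poly-id))

-- Logarithms and the approximation factor

-- The two bounds determine `l` as ⌈log₂ (d + 1)⌉.
log-bounds : ∀ d → ∃ λ l → suc d ≤ 2 ^ l × 2 ^ l ≤ suc (2 * d)
log-bounds zero    = 0 , ≤-refl , ≤-refl
log-bounds (suc d) with log-bounds d
... | l , lower , upper with suc (suc d) ≤? 2 ^ l
...   | yes d+2≤ = l , d+2≤ , ≤-trans upper (s≤s (*-monoʳ-≤ 2 (n≤1+n d)))
...   | no  d+2≰ = suc l
  , ≤-trans (s≤s (s≤s (m≤m+n d (d + 0)))) (≤-trans (≤-reflexive (sym (*-suc 2 d))) (*-monoʳ-≤ 2 lower))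
  , m≤n⇒m≤1+n (*-monoʳ-≤ 2 (≤-pred (≰⇒> d+2≰)))

log : ℕ → ℕ
log d = proj₁ (log-bounds d)

d<2^log : ∀ d → suc d ≤ 2 ^ log d
d<2^log d = proj₁ (proj₂ (log-bounds d))

2^log≤d³ : ∀ d → 2 ≤ d → 2 ^ log d ≤ d ^ 3
2^log≤d³ d 2≤d = begin
  2 ^ log d            ≤⟨ proj₂ (proj₂ (log-bounds d)) ⟩
  suc (2 * d)          ≤⟨ +-monoˡ-≤ (2 * d) (≤-trans (n≤1+n 1) (≤-trans 2≤d (m≤m+n d _))) ⟩
  2 * d + 2 * d        ≡⟨ *-distribʳ-+ d 2 2 ⟨
  2 * 2 * d            ≤⟨ *-monoˡ-≤ d (*-mono-≤ 2≤d 2≤d) ⟩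
  d * d * d            ≡⟨ trans (*-assoc d d d) (cong (λ x → d * (d * x)) (sym (*-identityʳ d))) ⟩
  d ^ 3                ∎
  where open ≤-Reasoning

-- The partial sums of e stay below 4. Strictness carries the induction: m e + 2 ≤ m (e + 1) once m
-- ≥ 2, hence two base cases.
expSum<4! : ∀ k → suc (expSum k) ≤ 4 * k !
expSum<4! zero          = s≤s (s≤s z≤n)
expSum<4! (suc zero)    = s≤s (s≤s (s≤s z≤n))
expSum<4! (suc (suc k)) = begin
  suc (m * e + 1)     ≡⟨ +-suc (m * e) 1 ⟨
  m * e + 2           ≤⟨ +-monoʳ-≤ (m * e) (s≤s (s≤s z≤n)) ⟩
  m * e + m           ≡⟨ trans (+-comm (m * e) m) (sym (*-suc m e)) ⟩
  m * suc e           ≤⟨ *-monoʳ-≤ m (expSum<4! (suc k)) ⟩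
  m * (4 * f)         ≡⟨ *-assoc m 4 f ⟨
  m * 4 * f           ≡⟨ cong (_* f) (*-comm m 4) ⟩
  4 * m * f           ≡⟨ *-assoc 4 m f ⟩
  4 * (m * f)         ∎
  where
  open ≤-Reasoning
  m = suc (suc k)
  e = expSum (suc k)
  f = suc k !

^-distribʳ-* : ∀ x m n → (m * n) ^ x ≡ m ^ x * n ^ x
^-distribʳ-* zero    m n = refl
^-distribʳ-* (suc x) m n = trans (cong (m * n *_) (^-distribʳ-* x m n)) ([m*n]*[o*p]≡[m*o]*[n*p] m n (m ^ x) (n ^ x))

≤·ln-intro : ∀ {x c d} → 4 ^ x ≤ d ^ c → x ≤ c ·ln d
≤·ln-intro {x} {c} {d} 4^x≤ k = begin
  expSum k ^ x           ≤⟨ ^-monoˡ-≤ x (<⇒≤ (expSum<4! k)) ⟩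
  (4 * k !) ^ x          ≡⟨ cong (_^ x) (*-comm 4 (k !)) ⟩
  (k ! * 4) ^ x          ≡⟨ ^-distribʳ-* x (k !) 4 ⟩
  (k !) ^ x * 4 ^ x      ≤⟨ *-monoʳ-≤ ((k !) ^ x) 4^x≤ ⟩
  (k !) ^ x * d ^ c      ∎
  where open ≤-Reasoning

-- One block of m steps for each of the 25 `log d` halvings, and one more block to descend from m to
-- 0.
ratio : ℕ → ℕ
ratio d = suc (log d * 5 * 5)

degree-bound : ∀ d → (suc d ^ 5) ^ 5 ≤ 2 ^ (log d * 5 * 5)
degree-bound d = begin
  (suc d ^ 5) ^ 5              ≤⟨ ^-monoˡ-≤ 5 (^-monoˡ-≤ 5 (d<2^log d)) ⟩
  ((2 ^ log d) ^ 5) ^ 5        ≡⟨ cong (_^ 5) (^-*-assoc 2 (log d) 5) ⟩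
  (2 ^ (log d * 5)) ^ 5        ≡⟨ ^-*-assoc 2 (log d * 5) 5 ⟩
  2 ^ (log d * 5 * 5)          ∎
  where open ≤-Reasoning

ratio-O[ln] : IsO[ln] ratio
-- 4 ^ `ratio d` is 2² (2 ^ `log d`)⁵⁰; for d ≥ 2, bounding 2 by d and 2 ^ `log d` by d³ gives the
-- exponent 2 + 3 · 50.
ratio-O[ln] = 2 + 3 * 50 , 2 , λ d 2≤d → ≤·ln-intro {ratio d} {2 + 3 * 50} {d} (begin
  4 ^ ratio d                        ≡⟨ ^-*-assoc 2 2 (ratio d) ⟩
  2 ^ (2 * ratio d)                  ≡⟨ cong (2 ^_) (exponent d) ⟩
  2 ^ (2 + log d * 50)               ≡⟨ ^-distribˡ-+-* 2 2 (log d * 50) ⟩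
  2 ^ 2 * 2 ^ (log d * 50)           ≡⟨ cong (2 ^ 2 *_) (^-*-assoc 2 (log d) 50) ⟨
  2 ^ 2 * (2 ^ log d) ^ 50           ≤⟨ *-mono-≤ (^-monoˡ-≤ 2 2≤d) (^-monoˡ-≤ 50 (2^log≤d³ d 2≤d)) ⟩
  d ^ 2 * (d ^ 3) ^ 50               ≡⟨ cong (d ^ 2 *_) (^-*-assoc d 3 50) ⟩
  d ^ 2 * d ^ (3 * 50)               ≡⟨ ^-distribˡ-+-* d 2 (3 * 50) ⟨
  d ^ (2 + 3 * 50)                   ∎)
  where
  open ≤-Reasoning
  exponent : ∀ d → 2 * ratio d ≡ 2 + log d * 50
  exponent d = begin-equality
    2 * suc (log d * 5 * 5)    ≡⟨ *-suc 2 _ ⟩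
    2 + 2 * (log d * 5 * 5)    ≡⟨ cong (λ x → 2 + 2 * x) (*-assoc (log d) 5 5) ⟩
    2 + 2 * (log d * 25)       ≡⟨ cong (2 +_) (trans (*-comm 2 (log d * 25)) (*-assoc (log d) 25 2)) ⟩
    2 + log d * 50             ∎

-- The program

positive⇒inhabited : ∀ {n} (G : Graph n) L → Constraints.potential G L ≢ 0 → Fin n
positive⇒inhabited {zero}  G L Φ≢0 = contradiction refl Φ≢0
positive⇒inhabited {suc n} G L Φ≢0 = zero

module _ {n : ℕ} (G : Graph n) where

  open Constraints G
  open Semantics G

  mark-greedy : ∀ ℓ {v a} → v ≡ firstZero (excess (Ψ ℓ)) → a ≡ potential (chosen ℓ) →
    GreedyStep (chosen ℓ) (chosen (mark ℓ v a))
  mark-greedy ℓ {v} {zero} _ a≡ = inj₁ (sym a≡ , λ u → cong (0 <ᵇ_) (unchanged (toℕ u)))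
    where
    unchanged : ∀ i → mark ℓ v 0 i ≡ ℓ i
    unchanged i with v ≡ᵇ i in eq
    ... | false = refl
    ... | true  = trans (+-identityʳ (ℓ v)) (cong ℓ (≡ᵇ⇒≡ v i (subst T (sym eq) _)))
  mark-greedy ℓ {v} {a@(suc _)} v≡ a≡ =
    let Φ≢0 = λ Φ≡0 → 0≢1+n (sym (trans a≡ Φ≡0))
        b , b-eq , b-min = argmin-spec (Ψ ℓ) (positive⇒inhabited G (chosen ℓ) Φ≢0)
    in inj₂ (Φ≢0 , b , b-min , λ u → trans (added (toℕ u)) (cong (λ c → (c ≡ᵇ toℕ u) ∨ chosen ℓ u) (trans v≡ b-eq)))
    where
    added : ∀ i → (0 <ᵇ mark ℓ v a i) ≡ (v ≡ᵇ i) ∨ (0 <ᵇ ℓ i)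
    added i with v ≡ᵇ i
    ... | false = refl
    ... | true  rewrite +-comm (ℓ v) a = refl

  next-greedy : ∀ ℓ → GreedyStep (chosen ℓ) (chosen (next ℓ))
  next-greedy ℓ = mark-greedy ℓ (choice-sem ℓ) (gap-sem ℓ)

  marks : ℕ → ℕ → ℕ
  marks zero    = λ _ → 0
  marks (suc t) = next (marks t)

  -- The size of an optimum is unknown to the program. The starting potential is enough rounds,
  -- since each loses at least 1 until 0.
  rounds : ℕ
  rounds = gap (marks 0)

  private
    g s : ℕ → ℕ
    g t = potential (chosen (marks t))
    s t = size (chosen (marks t))

    progress : ∀ {L} → Cover L → ∀ t → size L * g (suc t) + g t ≤ size L * g t
    progress cover t = step-progress cover (next-greedy (marks t))

  marks-cover : Cover (chosen (marks rounds))
  marks-cover = potential≡0⇒cover (chosen (marks rounds)) $ n≤0⇒n≡0 $ begin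
    g rounds            ≡⟨ cong g (+-identityʳ rounds) ⟨
    g (rounds + 0)      ≤⟨ Decay.descend (size {n} λ _ → true) g (progress cover-all) rounds 0 ⟩
    g 0 ∸ rounds        ≡⟨ m≤n⇒m∸n≡0 (≤-reflexive (sym (gap-sem (marks 0)))) ⟩
    0                   ∎
    where open ≤-Reasoning

  -- The potential is 0 after `ratio (Δ G) * size L` rounds, and later rounds add no vertex.
  marks-size : ∀ {L} → Cover L → ∀ t → s t ≤ ratio (Δ G) * size L
  marks-size {L} cover = Decay.stops (size L) g (progress cover) s (sum-zero {n} λ _ → refl)
    (λ t → step-size (next-greedy (marks t))) (λ t Φ≡0 → step-stop Φ≡0 (next-greedy (marks t)))
    (ratio (Δ G) * size L)
    (Decay.vanish (size L) g (progress cover) (log (Δ G) * 5 * 5)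
      (potential≤ (λ v → ≤-trans (hits≤ v) (degree-bound (Δ G))) (chosen (marks 0)) L cover))

  rounds≤ : rounds ≤ n ^ 5 * 3
  rounds≤ = begin
    rounds                         ≡⟨ gap-sem (marks 0) ⟩
    g 0                            ≤⟨ sums-mono 5 (λ q → ≤-trans (m∸n≤m (requirement q) (cov (chosen (marks 0)) q)) (requirement≤3 q)) ⟩
    sums 5 {n} (λ _ → 3)           ≡⟨ sums-const 5 n 3 ⟩
    n ^ 5 * 3                      ∎
    where
    open ≤-Reasoning
    requirement≤3 : ∀ q → requirement q ≤ 3
    requirement≤3 q = +-mono-≤ (+-mono-≤ (𝟙≤1 (valid q)) (𝟙≤1 (valid q))) (𝟙≤1 (valid q ∧ not (same q)))

gapᵗ : Term 0
gapᵗ = potentialᵗ chosenᵗ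

-- Array 3 counts the rounds left; arrays 4 and 5 receive the choice and the gap, both computed
-- before array 2 changes.
round greedy : Program
round =
  3 [ const 0 ]≔ 3 [ const 0 ] ⊖ const 1 ⨾
  compile [] 4 choiceᵗ ⨾
  compile [] 5 gapᵗ ⨾
  2 [ 4 [ const 0 ] ]≔ 2 [ 4 [ const 0 ] ] ⊕ 5 [ const 0 ]

greedy = compile [] 3 gapᵗ ⨾ while (3 [ const 0 ]) round

-- 6 and 9 are the costs of the first and last assignments of `round`.
roundTime : ℕ → ℕ
roundTime n = 6 + (time choiceᵗ n + (time gapᵗ n + 9))

-- Correctness and running time of the program

module _ {n : ℕ} (G : Graph n) where

  open Semantics G

  closed : ∀ {ℓ a σ} → 3 ≤ a → AgreeBelow 3 (memory ℓ) σ → Represents (memory ℓ) [] [] a σ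
  closed 3≤a memory≈σ = record { memory = memory≈σ ; 3≤a = 3≤a ; names = λ () ; values = λ () }

  Round : ℕ → Store → Set
  Round j σ = (∃ λ t → j + t ≡ rounds G × AgreeBelow 3 (memory (marks G t)) σ) × σ 3 0 ≡ j

  round-correct : ∀ j σ → Round (suc j) σ →
    ∃ λ τ → (⟨ round , σ ⟩⇓[ roundTime n ] τ) × Round j τ
  round-correct j σ ((t , j+t , memory≈σ) , ctr) =
    let ℓ = marks G t
        σ₁ = σ [ 3 , 0 ↦ σ 3 0 ∸ 1 ]
        R₁ = agree-trans ≤-refl memory≈σ (agree-update σ 3 0 (σ 3 0 ∸ 1))
        σ₂ , run₂ , σ₂4≡ , σ₁≈σ₂ = compile-correct choiceᵗ (closed {ℓ} (n≤1+n 3) R₁)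
        R₂ = agree-trans (n≤1+n 3) R₁ σ₁≈σ₂
        σ₃ , run₃ , σ₃5≡ , σ₂≈σ₃ = compile-correct gapᵗ (closed {ℓ} {5} (m≤n+m 3 2) R₂)
        R₃ = agree-trans (m≤n+m 3 2) R₂ σ₂≈σ₃
        σ₃4≡ : σ₃ 4 0 ≡ choice ℓ
        σ₃4≡ = trans (σ₂≈σ₃ 4 0 ≤-refl) σ₂4≡
        ctr₃ : σ₃ 3 0 ≡ j
        ctr₃ = trans (σ₂≈σ₃ 3 0 (n≤1+n 4)) (trans (σ₁≈σ₂ 3 0 ≤-refl) (cong (_∸ 1) ctr))
    in _ , ⇓seq ⇓assign (⇓seq run₂ (⇓seq run₃ ⇓assign)) ,
       (suc t , trans (+-suc j t) j+t , stored ℓ σ₃ σ₃4≡ σ₃5≡ R₃) , ctr₃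
    where
    stored : ∀ ℓ σ {v a} → σ 4 0 ≡ v → σ 5 0 ≡ a → AgreeBelow 3 (memory ℓ) σ →
      AgreeBelow 3 (memory (mark ℓ v a)) (σ [ 2 , σ 4 0 ↦ σ 2 (σ 4 0) + σ 5 0 ])
    stored ℓ σ refl refl R 0 i _ = R 0 i z<s
    stored ℓ σ refl refl R 1 i _ = R 1 i (s<s z<s)
    stored ℓ σ refl refl R 2 i _ rewrite R 2 (σ 4 0) (s<s (s<s z<s)) | R 2 i (s<s (s<s z<s)) = refl
    stored ℓ σ refl refl R (suc (suc (suc b))) i (s≤s (s≤s (s≤s ())))

  greedy-correct : ∃ λ τ →
    (⟨ greedy , input G ⟩⇓[ time gapᵗ n + loopTime (roundTime n) (rounds G) ] τ) ×
    (∀ i → τ 2 i ≡ marks G (rounds G) i)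
  greedy-correct =
    let σ , run , σ3≡ , input≈σ = compile-correct gapᵗ (closed ≤-refl initial)
        τ , loop , (t , t≡ , R) , _ = countdown Round (λ _ _ → proj₂) round-correct (rounds G) σ
          ((0 , +-identityʳ (rounds G) , agree-trans ≤-refl initial input≈σ) , σ3≡)
    in τ , ⇓seq run loop , λ i → subst (λ t → τ 2 i ≡ marks G t i) t≡ (R 2 i ≤-refl)
    where
    initial : AgreeBelow 3 (memory (marks G 0)) (input G)
    initial 0 i _ = refl
    initial 1 i _ = refl
    initial 2 i _ = refl
    initial (suc (suc (suc b))) i (s≤s (s≤s (s≤s ())))

greedy-polynomial : PolynomialTime greedy
greedy-polynomial =
  let c , k , bound = poly-+ (poly-time gapᵗ) (poly-loopTime roundTime-poly (poly-* (poly-^ 5 poly-id) (poly-const 3)))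
  in c , k , λ n G →
    let τ , run , _ = greedy-correct G
    in _ , τ , run , ≤-trans (+-monoʳ-≤ (time gapᵗ n) (loopTime-mono (roundTime n) (rounds≤ G))) (bound n)
  where
  roundTime-poly : PolyBounded roundTime
  roundTime-poly = poly-+ (poly-const 6) (poly-+ (poly-time choiceᵗ) (poly-+ (poly-time gapᵗ) (poly-const 9)))

marks-approximate : ∀ {n} (G : Graph n) σ → (∀ i → σ 2 i ≡ marks G (rounds G) i) →
  LiarsVEDominating G (output n σ) ×
  (∀ m → MinimumLiarsVECardinality G m → ∣ output n σ ∣ ≤ ratio (Δ G) * m)
marks-approximate {n} G σ σ2≡ =
    cover⇒liars (λ q → ≤-trans (marks-cover G q)
      (≤-reflexive (sum-cong-≗ λ u → cong (λ b → 𝟙 (dominators q u ∧ b)) (sym (output≡ u)))))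
  , λ m minimum → let L , liars , ∣L∣≡m = MinimumLiarsVECardinality.attained minimum in begin
      ∣ output n σ ∣                        ≡⟨ ∣∣≡size (output n σ) ⟩
      size (lookup (output n σ))            ≡⟨ sum-cong-≗ (cong 𝟙 ∘ output≡) ⟩
      size (chosen (marks G (rounds G)))    ≤⟨ marks-size G (liars⇒cover liars) (rounds G) ⟩
      ratio (Δ G) * size (lookup L)         ≡⟨ cong (ratio (Δ G) *_) (trans (sym (∣∣≡size L)) ∣L∣≡m) ⟩
      ratio (Δ G) * m                       ∎
  where
  open Constraints G
  open Semantics G
  open ≤-Reasoning
  output≡ : ∀ u → lookup (output n σ) u ≡ chosen (marks G (rounds G)) u
  output≡ u = trans (lookup∘tabulate (λ v → 0 <ᵇ σ 2 (toℕ v)) u) (cong (0 <ᵇ_) (σ2≡ (toℕ u)))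

greedy-approximates : ApproximatesMinimumLiarsVE ratio greedy
greedy-approximates n G t σ run =
  let τ , run′ , τ2≡ = greedy-correct G
  in marks-approximate G σ (subst (λ υ → ∀ i → υ 2 i ≡ marks G (rounds G) i) (deterministic run′ run) τ2≡)

theorem13 : ∃ λ (f : ℕ → ℕ) → IsO[ln] f ×
    (∃ λ (P : Program) → PolynomialTime P × ApproximatesMinimumLiarsVE f P)
theorem13 = ratio , ratio-O[ln] , greedy , greedy-polynomial , greedy-approximates
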